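{- Suppose that $G$ is a graph for which there exists a partition $\{S_1, \ldots, S_m\}$ of $V(G)$ such that for each $i$ the induced subgraph $G[S_i]$ is an odd cycle. Suppose that for each $i \geq 2$ each vertex in $S_i$ has at most $\rho$ neighbors in $\bigcup_{j=1}^{i-1} S_j$ (with $\rho = 0$ in the case that $m=1$). Then $AT(G \square P_k) \leq 3+\rho$ for every positive integer $k$.
   Context: All graphs are finite and simple, and digraphs are simple. $G[T]$ denotes the subgraph of $G$ induced by $T\subseteq V(G)$. $P_k$ is the path on $k$ vertices. The Cartesian product $G \square H$ has vertex set $V(G)\times V(H)$, with $(u,v)$ adjacent to $(u',v')$ iff either $u=u'$ and $vv'\in E(H)$, or $v=v'$ and $uu'\in E(G)$. A circulation contained in a digraph $D$ is a spanning subdigraph $E$ of $D$ such that $d^-_E(v)=d^+_E(v)$ (indegree equals outdegree in $E$) for every $v\in V(D)$; it is even (resp. odd) if it has an even (resp. odd) number of edges (the edgeless circulation is even). The Alon-Tarsi number $AT(G)$ is the smallest $k$ for which there is an orientation $D$ of $G$ with maximum indegree $k-1$ such that the number of even circulations and the number of odd circulations contained in $D$ are different. -}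

module Defs where

open import Data.Fin.Base using (Fin; toℕ)
import Data.Fin.Properties as Fin
open import Data.List.Base
  using (List; []; _∷_; _++_; length; map; filter; allFin; cartesianProduct)
open import Data.List.Extrema.Nat using (max)
open import Data.Nat.Base using (ℕ; suc; _+_; _*_; _≤_)
open import Data.Nat.Divisibility using (_∣_; _∣?_)
import Data.Nat.Properties as ℕ
open import Data.Product.Base using (_×_; _,_; ∃; ∃-syntax; proj₁; proj₂)
open import Data.Product.Function.NonDependent.Propositional using (_×-↔_)
open import Data.Sum.Base as Sum using (_⊎_; [_,_])
open import Function.Base using (_∘_)
open import Function.Bundles using (_↔_; _⇔_; module Inverse)
open import Function.Construct.Composition using (_↔-∘_)
open import Function.Construct.Identity using (↔-id)
open import Function.Construct.Symmetry using (↔-sym)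
open import Function.Properties.Inverse using (↔⇒↣)
open import Level using (0ℓ)
open import Relation.Binary.Core using (Rel)
open import Relation.Binary.Definitions
  using (Decidable; DecidableEquality; Irreflexive; Symmetric)
open import Relation.Binary.PropositionalEquality
  using (_≡_; _≢_; refl; sym; trans; cong; subst)
open import Relation.Nullary.Decidable using (Dec; map′; ¬?; _×-dec_; _⊎-dec_)
open import Relation.Nullary.Negation using (¬_)
open import Relation.Unary as U using (Pred)

record Finite (V : Set) : Set where
  field
    size        : ℕ
    enumeration : V ↔ Fin size

  open Inverse enumeration public using () renaming (to to index; from to unindex)

  vertices : List V
  vertices = map unindex (allFin size)

  infix 4 _≟_
  _≟_ : DecidableEquality V
  _≟_ = Fin.inj⇒≟ (↔⇒↣ enumeration)

  all? : {P : Pred V 0ℓ} → U.Decidable P → Dec (∀ v → P v)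
  all? {P} P? = map′
    (λ p v → subst P (Inverse.strictlyInverseʳ enumeration v) (p (index v)))
    (λ p → p ∘ unindex)
    (Fin.all? (P? ∘ unindex))

open Finite {{...}} public using (vertices; _≟_; all?)

instance
  finite-Fin : ∀ {n} → Finite (Fin n)
  finite-Fin {n} = record { size = n ; enumeration = ↔-id (Fin n) }

  finite-× : ∀ {V W} {{_ : Finite V}} {{_ : Finite W}} → Finite (V × W)
  finite-× {{F}} {{F′}} = record
    { size        = Finite.size F * Finite.size F′
    ; enumeration = ↔-sym Fin.*↔× ↔-∘ (Finite.enumeration F ×-↔ Finite.enumeration F′)
    }

-- Finiteness is kept apart from the graph structure, so that an induced
-- subgraph is a graph without further ado.
record Graph (V : Set) : Set₁ where
  field
    Adj    : Rel V 0ℓ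
    adj?   : Decidable Adj
    irrefl : Irreflexive _≡_ Adj
    symm   : Symmetric Adj

open Graph public

infix 4 _≅_
record _≅_ {V W : Set} (G : Graph V) (H : Graph W) : Set where
  field
    bijection : V ↔ W
    adjacency : ∀ u v →
      Adj G u v ⇔ Adj H (Inverse.to bijection u) (Inverse.to bijection v)

-- This is G[P] only for a proof-irrelevant P; Block part i below is one.
induced : {V : Set} → Graph V → (P : Pred V 0ℓ) → Graph (∃ P)
induced G P = record
  { Adj    = λ u v → Adj G (proj₁ u) (proj₁ v)
  ; adj?   = λ u v → adj? G (proj₁ u) (proj₁ v)
  ; irrefl = λ eq → irrefl G (cong proj₁ eq)
  ; symm   = symm G
  }

infixr 7 _□_
_□_ : {V W : Set} {{_ : Finite V}} {{_ : Finite W}} →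
      Graph V → Graph W → Graph (V × W)
G □ H = record
  { Adj    = λ (u , v) (u′ , v′) → (u ≡ u′ × Adj H v v′) ⊎ (v ≡ v′ × Adj G u u′)
  ; adj?   = λ (u , v) (u′ , v′) →
               ((u ≟ u′) ×-dec adj? H v v′) ⊎-dec ((v ≟ v′) ×-dec adj? G u u′)
  ; irrefl = λ { refl → [ irrefl H refl ∘ proj₂ , irrefl G refl ∘ proj₂ ] }
  ; symm   = Sum.map (λ (e , a) → sym e , symm H a) (λ (e , a) → sym e , symm G a)
  }

symmetrise : ∀ {n} (R : Rel (Fin n) 0ℓ) → Decidable R → Irreflexive _≡_ R → Graph (Fin n)
symmetrise R R? R-irrefl = record
  { Adj    = λ i j → R i j ⊎ R j i
  ; adj?   = λ i j → R? i j ⊎-dec R? j i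
  ; irrefl = λ { refl → [ R-irrefl refl , R-irrefl refl ] }
  ; symm   = Sum.swap
  }

path : ∀ k → Graph (Fin k)
path k = symmetrise (λ i j → toℕ j ≡ suc (toℕ i))
                    (λ i j → toℕ j ℕ.≟ suc (toℕ i))
                    (λ { refl eq → ℕ.1+n≢n (sym eq) })

cycle : ∀ ℓ → Graph (Fin (3 + ℓ))
cycle ℓ = symmetrise
  (λ i j → toℕ j ≡ suc (toℕ i) ⊎ (toℕ i ≡ 2 + ℓ × toℕ j ≡ 0))
  (λ i j → (toℕ j ℕ.≟ suc (toℕ i)) ⊎-dec ((toℕ i ℕ.≟ 2 + ℓ) ×-dec (toℕ j ℕ.≟ 0)))
  (λ { refl → [ (λ eq → ℕ.1+n≢n (sym eq))
              , (λ (last , first) → ℕ.1+n≢0 (trans (sym last) first)) ] })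

Even Odd : Pred ℕ 0ℓ
Even n = 2 ∣ n
Odd  n = ¬ Even n

even? : U.Decidable Even
even? n = 2 ∣? n

odd? : U.Decidable Odd
odd? n = ¬? (even? n)

IsOddCycle : {V : Set} → Graph V → Set
IsOddCycle G = ∃[ ℓ ] (Odd (3 + ℓ) × G ≅ cycle ℓ)

-- A partition {S₁,…,S_m} is given by the function sending a vertex to the index
-- of its block; indices start at 0.
Block : {V : Set} {m : ℕ} → (V → Fin m) → Fin m → Pred V 0ℓ
Block part i v = part v ≡ i

#earlierNeighbours : {V : Set} {{_ : Finite V}} {m : ℕ} →
                     Graph V → (V → Fin m) → V → Fin m → ℕ
#earlierNeighbours G part v i =
  length (filter (λ u → adj? G v u ×-dec (part u Fin.<? i)) vertices)

record Digraph (V : Set) : Set₁ where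
  field
    Arc        : Rel V 0ℓ
    arc?       : Decidable Arc
    arc-irrefl : Irreflexive _≡_ Arc

open Digraph public

record IsOrientation {V : Set} (D : Digraph V) (G : Graph V) : Set where
  field
    arc⇒adj  : ∀ {u v} → Arc D u v → Adj G u v
    adj⇒arc  : ∀ {u v} → Adj G u v → Arc D u v ⊎ Arc D v u
    one-way  : ∀ {u v} → Arc D u v → ¬ Arc D v u

sublists : {A : Set} → List A → List (List A)
sublists []       = [] ∷ []
sublists (x ∷ xs) = sublists xs ++ map (x ∷_) (sublists xs)

module _ {V : Set} {{_ : Finite V}} where

  -- (u , v) is the arc from u to v.
  arcs : Digraph V → List (V × V)
  arcs D = filter (λ (u , v) → arc? D u v) (cartesianProduct vertices vertices)

  indegree outdegree : List (V × V) → V → ℕ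
  indegree  E v = length (filter (λ a → proj₂ a ≟ v) E)
  outdegree E v = length (filter (λ a → proj₁ a ≟ v) E)

  maxIndegree : Digraph V → ℕ
  maxIndegree D = max 0 (map (indegree (arcs D)) vertices)

  Balanced : Pred (List (V × V)) 0ℓ
  Balanced E = ∀ v → indegree E v ≡ outdegree E v

  balanced? : U.Decidable Balanced
  balanced? E = all? (λ v → indegree E v ℕ.≟ outdegree E v)

  -- A spanning subdigraph is its set of arcs.  Since arcs D has no repetitions,
  -- sublists (arcs D) lists each such set exactly once.
  circulations : Digraph V → List (List (V × V))
  circulations D = filter balanced? (sublists (arcs D))

  #evenCirculations #oddCirculations : Digraph V → ℕ
  #evenCirculations D = length (filter (λ E → even? (length E)) (circulations D))
  #oddCirculations  D = length (filter (λ E → odd? (length E)) (circulations D))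

  AlonTarsiOrientation : Graph V → ℕ → Set₁
  AlonTarsiOrientation G k = ∃[ D ]
    ( IsOrientation D G
    × suc (maxIndegree D) ≡ k
    × #evenCirculations D ≢ #oddCirculations D )

  IsAlonTarsiNumber : Graph V → ℕ → Set₁
  IsAlonTarsiNumber G k =
    AlonTarsiOrientation G k × (∀ {j} → AlonTarsiOrientation G j → k ≤ j)

{-# OPTIONS --safe #-}
module Submission where

open import Defs
open import Algebra.Bundles using (CommutativeRing)
open import Algebra.Properties.CommutativeSemigroup using (interchange)
open import Data.Bool.Base using (Bool; true; false; not; _∧_; _xor_; if_then_else_)
open import Data.Bool.Properties
  using (xor-assoc; xor-comm; xor-identityʳ; xor-same; not-distribˡ-xor; ∧-zeroʳ; xor-∧-commutativeRing)
open import Data.Fin.Base using (Fin; zero; suc; toℕ; fromℕ)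
import Data.Fin.Properties as Fin
open import Data.List.Base
  using (List; []; _∷_; _++_; [_]; length; map; filter; concat; tabulate; allFin; cartesianProduct)
open import Data.List.Extrema.Nat using (max; max≤v⁺)
open import Data.List.Membership.Propositional using (_∈_; _∉_; find; lose)
open import Data.List.Membership.Propositional.Properties
  using ( ∈-∃++; ∈-map⁺; ∈-map⁻; ∈-++⁺ˡ; ∈-++⁺ʳ; ∈-++⁻; ∈-concat⁺′; ∈-concat⁻′; ∈-tabulate⁺; ∈-tabulate⁻
        ; ∈-filter⁺; ∈-filter⁻; ∈-allFin; ∈-cartesianProduct⁺)
open import Data.List.Membership.Propositional.Properties.WithK using (unique∧set⇒bag)
open import Data.List.Properties
  using (filter-accept; filter-reject; filter-≐; filter-none; length-map; map-++; ++-identityʳ)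
open import Data.List.Relation.Binary.BagAndSetEquality using (∼bag⇒↭)
open import Data.List.Relation.Binary.Disjoint.Propositional using (Disjoint)
open import Data.List.Relation.Binary.Permutation.Propositional as ↭
  using (_↭_; ↭-refl; ↭-trans; ↭-sym; prep; swap)
open import Data.List.Relation.Binary.Permutation.Propositional.Properties as ↭
  using (filter-↭; ↭-length; ∈-resp-↭; shift; shifts)
open import Data.List.Relation.Binary.Pointwise using (Pointwise; []; _∷_)
open import Data.List.Relation.Binary.Subset.Propositional using (_⊆_)
open import Data.List.Relation.Unary.All as All using (All; []; _∷_)
import Data.List.Relation.Unary.All.Properties as All
open import Data.List.Relation.Unary.AllPairs as AllPairs using ([]; _∷_)
import Data.List.Relation.Unary.AllPairs.Properties as AllPairs
open import Data.List.Relation.Unary.Any using (Any; here; there; any?)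
open import Data.List.Relation.Unary.Unique.Propositional using (Unique)
import Data.List.Relation.Unary.Unique.Propositional.Properties as Unique
open import Data.Nat.Base using (ℕ; zero; suc; _+_; _≤_; _<_; s≤s; z≤n)
open import Data.Nat.Divisibility using (divides; ∣m+n∣m⇒∣n; ∣m∣n⇒∣m+n)
open import Data.Nat.Induction using (<-rec)
open import Data.Nat.ListAction using (sum)
open import Data.Nat.ListAction.Properties using (sum-↭)
import Data.Nat.Properties as ℕ
open import Data.Nat.Tactic.RingSolver using (solve-∀)
open import Data.Product.Base as Product using (_×_; _,_; ∃; ∃-syntax; proj₁; proj₂)
open import Data.Sum.Base as Sum using (_⊎_; inj₁; inj₂; [_,_]′)
open import Function.Base using (_∘_; case_of_; id)
open import Function.Bundles using (_⇔_; mk⇔; module Equivalence; module Inverse)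
open import Level using (0ℓ)
open import Relation.Binary.Definitions using (tri<; tri≈; tri>)
open import Relation.Binary.PropositionalEquality
  using (_≡_; _≢_; refl; sym; trans; cong; cong₂; subst; subst₂; module ≡-Reasoning)
open import Relation.Nullary.Decidable
  using (Dec; yes; no; does; map′; ¬?; _×-dec_; _⊎-dec_; _→-dec_; does-⇔; dec-true; dec-false)
open import Relation.Nullary.Negation using (¬_; contradiction)
open import Relation.Unary using (Pred; Decidable)

-- All counts are modulo 2: if an orientation has an odd number of circulations,
-- then its even and odd circulations cannot be equally many.  Reversing the
-- circulations of an orientation D gives exactly the orientations with the
-- in-degrees of D, so it suffices to prescribe in-degrees that are realised by an
-- odd number of orientations; D is then any one of these.
--
-- Arcs between blocks are directed towards the later block.  They lie on no
-- circulation, and contribute at most ρ to an in-degree.  What is left is the disjoint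
-- union of the prisms G[Sᵢ] □ P_k, for which in-degrees at most 2 have to be found.
-- Ask for in-degree 2 on every row but the last, where it is 2 at vertex 0
-- and 1 elsewhere, except that one vertex l of the first row gets 1 less.  Expanding
-- the product of (x_u + x_v) over the edges of the first row and of the rungs above it
-- modulo 2 replaces the defect at l by the sum of the defects at l′ in the second
-- row, over all l′ ≠ l.  The number of orientations of the last row alone is 0 for
-- l = 0 and 1 for l ≠ 0, and since the length n of the cycle is odd, this function of l
-- is preserved by that substitution.  Hence any l ≠ 0 will do.

-- Sums modulo 2, and the edge lists of ladders, rings and grids

⨁ : ∀ {n} → (Fin n → Bool) → Bool
⨁ {zero}  b = false
⨁ {suc n} b = b zero xor ⨁ (b ∘ suc)

⨁-cong : ∀ {n} {b c : Fin n → Bool} → (∀ x → b x ≡ c x) → ⨁ b ≡ ⨁ c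
⨁-cong {zero}  eq = refl
⨁-cong {suc n} eq = cong₂ _xor_ (eq zero) (⨁-cong (eq ∘ suc))

⨁-even : ∀ n → Even n → ∀ b → ⨁ {n} (λ _ → b) ≡ false
⨁-even zero          e b = refl
⨁-even (suc zero)    (divides (suc q) ()) b
⨁-even (suc (suc n)) e b = trans (sym (xor-assoc b b _))
  (trans (cong (_xor ⨁ {n} (λ _ → b)) (xor-same b)) (⨁-even n (∣m+n∣m⇒∣n {m = 2} e (divides 1 refl)) b))

-- Edges are listed at the endpoint that is eliminated first.
fans : ∀ {X : Set} {n} → (Fin n → X) → (Fin n → List X) → List (X × X)
fans g forward = concat (tabulate λ x → map (g x ,_) (forward x))

-- Serves both for the edges along a row and for the rungs, where the function runs up a column.
nexts : ∀ {X : Set} k → (Fin (suc k) → X) → Fin (suc k) → List X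
nexts zero    g x       = []
nexts (suc k) g zero    = [ g (suc zero) ]
nexts (suc k) g (suc x) = nexts k (g ∘ suc) x

-- Vertex zero lists both of its ring edges, including the one that closes the ring, so that its
-- elimination leaves a path on the other vertices.
ringNexts : ∀ {X : Set} m → (Fin (2 + m) → X) → Fin (2 + m) → List X
ringNexts m g zero    = g (suc zero) ∷ g (fromℕ (suc m)) ∷ []
ringNexts m g (suc x) = nexts m (g ∘ suc) x

ring : ∀ {X : Set} m → (Fin (2 + m) → X) → (Fin (2 + m) → List X) → List (X × X)
ring m g up = fans g (λ x → ringNexts m g x ++ up x)

grid : ∀ {X : Set} k m → (Fin (suc k) → Fin (2 + m) → X) → List (X × X)
grid k m G = concat (tabulate λ t → ring m (G t) (λ x → nexts k (λ t′ → G t′ x) t))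

nexts-All : ∀ {X : Set} {P : X → Set} k {g : Fin (suc k) → X} →
            (∀ x → P (g x)) → ∀ x → All P (nexts k g x)
nexts-All zero    Pg x       = []
nexts-All (suc k) Pg zero    = Pg (suc zero) ∷ []
nexts-All (suc k) Pg (suc x) = nexts-All k (Pg ∘ suc) x

-- Expanding a product over edges modulo 2

module _ {X : Set} {{_ : Finite X}} where

  opaque
    count : X → List X → ℕ
    count v p = length (filter (_≟ v) p)

    count-hit : ∀ v p → count v (v ∷ p) ≡ suc (count v p)
    count-hit v p = cong length (filter-accept (_≟ v) refl)

    count-miss : ∀ {v a} p → a ≢ v → count v (a ∷ p) ≡ count v p
    count-miss {v} p a≢v = cong length (filter-reject (_≟ v) a≢v)

    count-↭ : ∀ v {p q} → p ↭ q → count v p ≡ count v q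
    count-↭ v p↭q = ↭-length (filter-↭ (_≟ v) p↭q)

  count-weaken : ∀ v a p → count v p ≤ count v (a ∷ p)
  count-weaken v a p = case a ≟ v of λ where
    (yes refl) → subst (count v p ≤_) (sym (count-hit v p)) (ℕ.n≤1+n _)
    (no a≢v)   → ℕ.≤-reflexive (sym (count-miss p a≢v))

  -- The sum modulo 2 of H over all choices of a head for every edge of L.  The argument of H
  -- is the multiset of the chosen heads and of p.
  expand : List (X × X) → (List X → Bool) → List X → Bool
  expand []            H p = H p
  expand ((u , v) ∷ L) H p = expand L H (v ∷ p) xor expand L H (u ∷ p)

  Invariant : (List X → Bool) → Set
  Invariant H = ∀ {p q} → p ↭ q → H p ≡ H q

  expand-invariant : ∀ L {H} → Invariant H → Invariant (expand L H)
  expand-invariant []            inv r = inv r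
  expand-invariant ((u , v) ∷ L) inv r =
    cong₂ _xor_ (expand-invariant L inv (prep v r)) (expand-invariant L inv (prep u r))

  expand-++ : ∀ L M H p → expand (L ++ M) H p ≡ expand L (expand M H) p
  expand-++ []            M H p = refl
  expand-++ ((u , v) ∷ L) M H p = cong₂ _xor_ (expand-++ L M H (v ∷ p)) (expand-++ L M H (u ∷ p))

  Avoids : X → List (X × X) → Set
  Avoids v = All (λ e → proj₁ e ≢ v × proj₂ e ≢ v)

  fans-avoids : ∀ {n v} {g : Fin n → X} {forward} → (∀ x → g x ≢ v) →
                (∀ x → All (_≢ v) (forward x)) → Avoids v (fans g forward)
  fans-avoids g≢v f≢v =
    All.concat⁺ (All.tabulate⁺ λ x → All.map⁺ (All.map (g≢v x ,_) (f≢v x)))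

  twice : ∀ {n} → (Fin n → X) → List X → List X
  twice {zero}  g p = p
  twice {suc n} g p = twice (g ∘ suc) (g zero ∷ g zero ∷ p)

  once : ∀ {n} → (Fin n → X) → List X → List X
  once {zero}  g p = p
  once {suc n} g p = once (g ∘ suc) (g zero ∷ p)

  twice-↭ : ∀ {n} (g : Fin n → X) {p q} → p ↭ q → twice g p ↭ twice g q
  twice-↭ {zero}  g r = r
  twice-↭ {suc n} g r = twice-↭ (g ∘ suc) (prep _ (prep _ r))

  ↭-third : ∀ {a b c : X} {p} → a ∷ b ∷ c ∷ p ↭ c ∷ a ∷ b ∷ p
  ↭-third = ↭-trans (prep _ (swap _ _ ↭-refl)) (swap _ _ ↭-refl)

  twice-++ : ∀ {n} (g : Fin n → X) ys p → twice g (ys ++ p) ↭ ys ++ twice g p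
  twice-++ {zero}  g ys p = ↭-refl
  twice-++ {suc n} g ys p =
    ↭-trans (twice-↭ (g ∘ suc) (shifts (g zero ∷ g zero ∷ []) ys)) (twice-++ (g ∘ suc) ys _)

  Clean : ∀ {n} → (Fin n → X) → List X → Set
  Clean g p = ∀ x → count (g x) p ≡ 0

  clean-∷ : ∀ {n} {g : Fin n → X} {a p} → (∀ x → a ≢ g x) → Clean g p → Clean g (a ∷ p)
  clean-∷ a≢g c x = trans (count-miss _ (a≢g x)) (c x)

  -- Eliminating one vertex at a time

  module Elimination (cap : X → ℕ) where

    -- An exact demand: `H` vanishes unless `v` is head exactly `cap v` times.
    Capped : (List X → Bool) → X → Set
    Capped H v = ∀ p → count v p ≢ cap v → H p ≡ false

    -- Edges that avoid `v` add no head at `v`, so the demand at `v` survives their expansion. Hence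
    -- the edges at `v` can be decided first, with the expansion of all later edges in the role of
    -- `H`.
    expand-capped : ∀ {v} L {H} → Avoids v L → Capped H v → Capped (expand L H) v
    expand-capped []            []               c p ne = c p ne
    expand-capped ((a , b) ∷ L) ((a≢ , b≢) ∷ av) c p ne = cong₂ _xor_
      (expand-capped L av c _ (ne ∘ trans (sym (count-miss p b≢))))
      (expand-capped L av c _ (ne ∘ trans (sym (count-miss p a≢))))

    fan : X → List X → List (X × X)
    fan v = map (v ,_)

    module _ {H : List X → Bool} {v : X} (capped : Capped H v) where

      -- Heads are only ever added, so an excess at `v` is never repaired.
      over : ∀ as p → cap v < count v p → expand (fan v as) H p ≡ false
      over []       p lt = capped p (ℕ.<⇒≢ lt ∘ sym)
      over (a ∷ as) p lt = cong₂ _xor_ (over as _ lt′) (over as _ lt″)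
        where
        lt″ = ℕ.<-≤-trans lt (count-weaken v v p)
        lt′ = ℕ.<-≤-trans lt (count-weaken v a p)

      under : ∀ as p → All (_≢ v) as → count v p + length as < cap v →
              expand (fan v as) H p ≡ false
      under []       p []          lt = capped p (ℕ.<⇒≢ (subst (_< cap v) (ℕ.+-identityʳ _) lt))
      under (a ∷ as) p (a≢v ∷ as≢) lt = cong₂ _xor_
        (under as _ as≢ (ℕ.≤-<-trans (ℕ.≤-trans (ℕ.≤-reflexive (cong (_+ length as) (count-miss p a≢v)))
                                               (ℕ.+-monoʳ-≤ (count v p) (ℕ.n≤1+n _))) lt))
        (under as _ as≢ (subst (_< cap v) (trans (ℕ.+-suc _ _) (cong (_+ length as) (sym (count-hit v p)))) lt))

      -- As `v` is full, the term in which the edge enters `v` vanishes by `over`.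
      skip : ∀ a as p → count v p ≡ cap v →
             expand (fan v (a ∷ as)) H p ≡ expand (fan v as) H (a ∷ p)
      skip a as p eq = trans
        (cong (expand (fan v as) H (a ∷ p) xor_)
          (over as _ (ℕ.≤-reflexive (trans (cong suc (sym eq)) (sym (count-hit v p))))))
        (xor-identityʳ _)

      -- All the remaining edges are needed to fill `v`, so the term in which one of them leaves
      -- vanishes by `under`.
      take : ∀ a as p → All (_≢ v) (a ∷ as) → count v p + length (a ∷ as) ≡ cap v →
             expand (fan v (a ∷ as)) H p ≡ expand (fan v as) H (v ∷ p)
      take a as p (a≢v ∷ as≢) eq = cong (_xor _) (under as _ as≢ (ℕ.≤-reflexive
        (trans (cong (λ c → suc (c + length as)) (count-miss p a≢v))
               (trans (sym (ℕ.+-suc _ _)) eq))))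

      module _ (two : cap v ≡ 2) where

        -- In these names the subscript is the number of edges at `v`, and the suffix the number of
        -- heads already there. The terms on the right are the ways to choose the heads still
        -- missing from two.
        elim₂-0 : ∀ {a b} p → a ≢ v → b ≢ v → count v p ≡ 0 →
                  expand (fan v (a ∷ b ∷ [])) H p ≡ H (v ∷ v ∷ p)
        elim₂-0 {a} {b} p a≢ b≢ c = trans
          (take a _ p (a≢ ∷ b≢ ∷ []) (trans (cong (_+ 2) c) (sym two)))
          (take b _ _ (b≢ ∷ []) (trans (cong (_+ 1) (trans (count-hit v p) (cong suc c))) (sym two)))

        elim₂-1 : ∀ {a b} p → a ≢ v → b ≢ v → count v p ≡ 1 →
                  expand (fan v (a ∷ b ∷ [])) H p ≡ H (v ∷ a ∷ p) xor H (b ∷ v ∷ p)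
        elim₂-1 {a} {b} p a≢ b≢ c = cong₂ _xor_
          (take b _ _ (b≢ ∷ []) (trans (cong (_+ 1) (trans (count-miss p a≢) c)) (sym two)))
          (skip b [] (v ∷ p) (trans (count-hit v p) (trans (cong suc c) (sym two))))

        elim₂-2 : ∀ {a b} p → a ≢ v → count v p ≡ 2 →
                  expand (fan v (a ∷ b ∷ [])) H p ≡ H (b ∷ a ∷ p)
        elim₂-2 {a} {b} p a≢ c = trans
          (skip a (b ∷ []) p (trans c (sym two)))
          (skip b [] (a ∷ p) (trans (count-miss p a≢) (trans c (sym two))))

        elim₃-0 : ∀ {a b c} p → a ≢ v → b ≢ v → c ≢ v → count v p ≡ 0 →
                  expand (fan v (a ∷ b ∷ c ∷ [])) H p ≡
                  H (v ∷ v ∷ a ∷ p) xor (H (v ∷ b ∷ v ∷ p) xor H (c ∷ v ∷ v ∷ p))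
        elim₃-0 p a≢ b≢ c≢ c = cong₂ _xor_
          (elim₂-0 _ b≢ c≢ (trans (count-miss p a≢) c))
          (elim₂-1 _ b≢ c≢ (trans (count-hit v p) (cong suc c)))

        elim₃-1 : ∀ {a b c} p → a ≢ v → b ≢ v → c ≢ v → count v p ≡ 1 →
                  expand (fan v (a ∷ b ∷ c ∷ [])) H p ≡
                  (H (v ∷ b ∷ a ∷ p) xor H (c ∷ v ∷ a ∷ p)) xor H (c ∷ b ∷ v ∷ p)
        elim₃-1 p a≢ b≢ c≢ c = cong₂ _xor_
          (elim₂-1 _ b≢ c≢ (trans (count-miss p a≢) c))
          (elim₂-2 _ b≢ (trans (count-hit v p) (cong suc c)))

    -- A path g with a rung from each g x to y x.  It has one edge less than what cap asks for
    -- on g, hence one precharged vertex forces all rungs onto g, and two precharged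
    -- vertices leave the head of exactly one rung at y.
    ladder : ∀ m (g y : Fin (suc m) → X) → List (X × X)
    ladder m g y = fans g (λ x → nexts m g x ++ [ y x ])

    record Strip {m} (g y : Fin (suc m) → X) (H : List X → Bool) : Set where
      field
        injective : ∀ {x x′} → g x ≡ g x′ → x ≡ x′
        off       : ∀ x x′ → y x ≢ g x′
        capped    : ∀ x → Capped H (g x)
        two       : ∀ x → cap (g x) ≡ 2
        invariant : Invariant H

    tailStrip : ∀ {m g y H} → Strip {suc m} g y H → Strip {m} (g ∘ suc) (y ∘ suc) H
    tailStrip s = record
      { injective = λ eq → Fin.suc-injective (injective eq)
      ; off = λ x x′ → off (suc x) (suc x′)
      ; capped = capped ∘ suc
      ; two = two ∘ suc
      ; invariant = invariant }
      where
      open Strip s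

    module _ {m} {g y : Fin (suc (suc m)) → X} {H} (s : Strip g y H) where
      open Strip s

      head≢ : ∀ x → g (suc x) ≢ g zero
      head≢ x eq with () ← injective eq

      tailCapped : Capped (expand (ladder m (g ∘ suc) (y ∘ suc)) H) (g zero)
      tailCapped = expand-capped (ladder m (g ∘ suc) (y ∘ suc))
        (fans-avoids head≢ λ x → All.++⁺ (nexts-All m head≢ x) (off (suc x) zero ∷ []))
        (capped zero)

    step-clean : ∀ {m} {g : Fin (suc (suc m)) → X} → (∀ {x x′} → g x ≡ g x′ → x ≡ x′) →
                 ∀ {p} → Clean g p → Clean (g ∘ suc) (g zero ∷ g zero ∷ p)
    step-clean inj c = clean-∷ ne (clean-∷ ne (c ∘ suc))
      where ne : ∀ x → _ ≢ _
            ne x eq with () ← inj eq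

    -- Vertex zero needs both of its edges, which leaves a shorter ladder that is again uncharged.
    -- The last vertex then has only its rung, one edge too few.
    ladder-0 : ∀ m {g y H} → Strip {m} g y H → ∀ p → Clean g p →
               expand (ladder m g y) H p ≡ false
    ladder-0 zero s p c = under (capped zero) (_ ∷ []) p (off zero zero ∷ [])
      (ℕ.≤-reflexive (trans (cong (λ n → suc (n + 1)) (c zero)) (sym (two zero))))
      where open Strip s
    ladder-0 (suc m) s p c = trans
      (elim₂-0 (tailCapped s) (two zero) p (head≢ s zero) (off zero zero) (c zero))
      (ladder-0 m (tailStrip s) _ (step-clean injective c))
      where open Strip s

    ladder-1 : ∀ m {g y H} → Strip {m} g y H → ∀ p → Clean g p → ∀ x →
               expand (ladder m g y) H (g x ∷ p) ≡ H (twice g p)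
    ladder-1 zero s p c zero = take (capped zero) _ [] _ (off zero zero ∷ [])
      (trans (cong (_+ 1) (trans (count-hit _ p) (cong suc (c zero)))) (sym (two zero)))
      where open Strip s
    ladder-1 (suc m) {g} {y} {H} s p c zero = begin
      _
        ≡⟨ elim₂-1 (tailCapped s) (two zero) _ (head≢ s zero) (off zero zero)
             (trans (count-hit _ p) (cong suc (c zero))) ⟩
      -- Either the rung enters and the path edge passes the charge on to the next vertex, or the
      -- rung leaves and the shorter ladder is uncharged, which contributes 0 by `ladder-0`.
      K (g zero ∷ g (suc zero) ∷ g zero ∷ p) xor K (y zero ∷ g zero ∷ g zero ∷ p)
        ≡⟨ cong₂ _xor_
             (trans (expand-invariant (ladder m (g ∘ suc) (y ∘ suc)) invariant (swap _ _ ↭-refl))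
                    (ladder-1 m (tailStrip s) _ (step-clean injective c) zero))
             (ladder-0 m (tailStrip s) _ (clean-∷ (off zero ∘ suc) (step-clean injective c))) ⟩
      H (twice g p) xor false
        ≡⟨ xor-identityʳ _ ⟩
      H (twice g p) ∎
      where open Strip s
            open ≡-Reasoning
            K = expand (ladder m (g ∘ suc) (y ∘ suc)) H
    ladder-1 (suc m) {g} {y} {H} s p c (suc x) = begin
      _
        ≡⟨ elim₂-0 (tailCapped s) (two zero) _ (head≢ s zero) (off zero zero)
             (trans (count-miss p (head≢ s x)) (c zero)) ⟩
      K (g zero ∷ g zero ∷ g (suc x) ∷ p)
        ≡⟨ expand-invariant (ladder m (g ∘ suc) (y ∘ suc)) invariant ↭-third ⟩
      K (g (suc x) ∷ g zero ∷ g zero ∷ p)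
        ≡⟨ ladder-1 m (tailStrip s) _ (step-clean injective c) x ⟩
      H (twice g p) ∎
      where open Strip s
            open ≡-Reasoning
            K = expand (ladder m (g ∘ suc) (y ∘ suc)) H

-- Ladders with two charges, and one row of the prism

module _ {X : Set} {{_ : Finite X}} (cap : X → ℕ) where
  open Elimination cap
  open Strip

  twice-∷ : ∀ {n} (g : Fin n → X) {H} → Invariant H → ∀ a p → H (twice g (a ∷ p)) ≡ H (a ∷ twice g p)
  twice-∷ g inv a p = inv (twice-++ g [ a ] p)

  -- Charges at both ends drive the path edges towards the one vertex whose rung leaves. Every
  -- vertex can be that one, each in exactly one way.
  ladder-ends : ∀ m {g y H} → Strip {m} g y H → ∀ p → Clean g p →
                expand (ladder m g y) H (g zero ∷ g (fromℕ m) ∷ p) ≡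
                ⨁ (λ x → H (y x ∷ twice g p))
  ladder-ends zero {g} {y} {H} s p c = trans
    (skip (capped s zero) (y zero) [] _
      (trans (count-hit _ _) (trans (cong suc (trans (count-hit _ p) (cong suc (c zero)))) (sym (two s zero)))))
    (sym (xor-identityʳ _))
  ladder-ends (suc m) {g} {y} {H} s p c = begin
    _
      ≡⟨ elim₂-1 (tailCapped s) (two s zero) _ (head≢ s zero) (off s zero zero)
           (trans (count-hit _ _) (cong suc (trans (count-miss p (head≢ s (fromℕ m))) (c zero)))) ⟩
    K (g zero ∷ g (suc zero) ∷ g zero ∷ z ∷ p) xor K (y zero ∷ g zero ∷ g zero ∷ z ∷ p)
      ≡⟨ cong₂ _xor_
           (trans (Kinv (↭-trans (swap _ _ ↭-refl) (prep _ ↭-third)))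
                  (ladder-ends m (tailStrip s) _ c′))
           (trans (Kinv (shift z (y zero ∷ g zero ∷ g zero ∷ []) p))
             (trans (ladder-1 m (tailStrip s) _ (clean-∷ (off s zero ∘ suc) c′) (fromℕ m))
                    (twice-∷ (g ∘ suc) (invariant s) _ _))) ⟩
    ⨁ (λ x → H (y (suc x) ∷ twice g p)) xor H (y zero ∷ twice g p)
      ≡⟨ xor-comm _ (H (y zero ∷ twice g p)) ⟩
    _ ∎
    where open ≡-Reasoning
          z = g (suc (fromℕ m))
          K = expand (ladder m (g ∘ suc) (y ∘ suc)) H
          Kinv = expand-invariant (ladder m (g ∘ suc) (y ∘ suc)) (invariant s)
          c′ = step-clean (injective s) c

  -- With charges at `zero` and `x` the rung that leaves is one of those up to `x`; with charges at
  -- `x` and the last vertex it is one of those from `x` on. Only the rung at `x` occurs in both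
  -- sums, and there it cancels.
  ladder-2 : ∀ m {g y H} → Strip {m} g y H → ∀ p → Clean g p → ∀ x →
             expand (ladder m g y) H (g zero ∷ g x ∷ p) xor
             expand (ladder m g y) H (g (fromℕ m) ∷ g x ∷ p) ≡
             ⨁ (λ x′ → H (y x′ ∷ twice g p)) xor H (y x ∷ twice g p)
  ladder-2 zero {g} {y} {H} s p c zero = trans (xor-same (expand (ladder zero g y) H (g zero ∷ g zero ∷ p)))
    (sym (trans (cong (_xor b) (xor-identityʳ b)) (xor-same b)))
    where b = H (y zero ∷ twice g p)
  ladder-2 (suc m) {g} {y} {H} s p c zero = begin
    _
      ≡⟨ cong₂ _xor_
           (trans (elim₂-2 (tailCapped s) (two s zero) _ (head≢ s zero) c₂)
             (trans (Kinv (swap _ _ ↭-refl))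
               (trans (ladder-1 m (tailStrip s) _ (clean-∷ (off s zero ∘ suc) c′) zero)
                 (twice-∷ (g ∘ suc) (invariant s) _ _))))
           (trans (expand-invariant (ladder (suc m) g y) (invariant s) (swap _ _ ↭-refl))
             (ladder-ends (suc m) s p c)) ⟩
    H (y zero ∷ twice g p) xor ⨁ (λ x′ → H (y x′ ∷ twice g p))
      ≡⟨ xor-comm (H (y zero ∷ twice g p)) _ ⟩
    _ ∎
    where open ≡-Reasoning
          K = expand (ladder m (g ∘ suc) (y ∘ suc)) H
          Kinv = expand-invariant (ladder m (g ∘ suc) (y ∘ suc)) (invariant s)
          c′ = step-clean (injective s) c
          c₂ = trans (count-hit _ _) (cong suc (trans (count-hit _ p) (cong suc (c zero))))
  ladder-2 (suc m) {g} {y} {H} s p c (suc x) = begin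
    _
      ≡⟨ cong₂ _xor_
           (trans (elim₂-1 (tailCapped s) (two s zero) _ (head≢ s zero) (off s zero zero)
                    (trans (count-hit _ _) (cong suc c₁)))
             (cong₂ _xor_
               (Kinv (↭-trans (swap _ _ ↭-refl) (prep _ ↭-third)))
               (trans (Kinv (shift w (y zero ∷ g zero ∷ g zero ∷ []) p))
                 (trans (ladder-1 m (tailStrip s) _ (clean-∷ (off s zero ∘ suc) c′) x)
                   (twice-∷ (g ∘ suc) (invariant s) _ _)))))
           (trans (elim₂-0 (tailCapped s) (two s zero) _ (head≢ s zero) (off s zero zero)
                    (trans (count-miss _ (head≢ s (fromℕ m))) c₁))
             (Kinv (↭-trans ↭-third (prep _ ↭-third)))) ⟩
    -- A charge at vertex zero allows its rung to leave, which gives `b`. Without one, vertex zero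
    -- must take both of its edges. The two terms in `K` form the same sum on the shorter ladder.
    (K (g (suc zero) ∷ w ∷ p′) xor b) xor K (g (suc (fromℕ m)) ∷ w ∷ p′)
      ≡⟨ cong (_xor K (g (suc (fromℕ m)) ∷ w ∷ p′)) (xor-comm (K (g (suc zero) ∷ w ∷ p′)) b) ⟩
    (b xor K (g (suc zero) ∷ w ∷ p′)) xor K (g (suc (fromℕ m)) ∷ w ∷ p′)
      ≡⟨ xor-assoc b _ _ ⟩
    b xor (K (g (suc zero) ∷ w ∷ p′) xor K (g (suc (fromℕ m)) ∷ w ∷ p′))
      ≡⟨ cong (b xor_) (ladder-2 m (tailStrip s) p′ c′ x) ⟩
    b xor (⨁ (λ x′ → H (y (suc x′) ∷ twice g p)) xor H (y (suc x) ∷ twice g p))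
      ≡⟨ sym (xor-assoc b _ _) ⟩
    _ ∎
    where open ≡-Reasoning
          w = g (suc x)
          p′ = g zero ∷ g zero ∷ p
          b = H (y zero ∷ twice g p)
          K = expand (ladder m (g ∘ suc) (y ∘ suc)) H
          Kinv = expand-invariant (ladder m (g ∘ suc) (y ∘ suc)) (invariant s)
          c′ = step-clean (injective s) c
          c₁ = trans (count-miss p (head≢ s x)) (c zero)

  -- If the rung at zero enters, both ends of the remaining path are charged. If it leaves, one ring
  -- edge enters zero and the other charges an end of the path; the two choices give equal terms and
  -- cancel.
  ring-zero : ∀ m {g y H} → Strip {suc m} g y H → ∀ p → Clean g p →
              expand (ring m g (λ x → [ y x ])) H (g zero ∷ p) ≡
              ⨁ (λ x → H (y (suc x) ∷ twice g p))
  ring-zero m {g} {y} {H} s p c = begin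
    _
      ≡⟨ elim₃-1 (tailCapped s) (two s zero) _ (head≢ s zero) (head≢ s (fromℕ m)) (off s zero zero)
           (trans (count-hit _ _) (cong suc (c zero))) ⟩
    (K (g zero ∷ z ∷ a ∷ g zero ∷ p) xor K (y zero ∷ g zero ∷ a ∷ g zero ∷ p))
      xor K (y zero ∷ z ∷ g zero ∷ g zero ∷ p)
      ≡⟨ cong₂ _xor_
           (cong₂ _xor_
             (trans (Kinv (↭-trans ↭-third (prep _ (swap _ _ ↭-refl)))) (ladder-ends m (tailStrip s) _ c′))
             (trans (Kinv ↭-third) (one zero)))
           (trans (Kinv (swap _ _ ↭-refl)) (one (fromℕ m))) ⟩
    (Σ xor b) xor b
      ≡⟨ xor-assoc Σ b b ⟩
    Σ xor (b xor b)
      ≡⟨ cong (Σ xor_) (xor-same b) ⟩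
    Σ xor false
      ≡⟨ xor-identityʳ Σ ⟩
    Σ ∎
    where open ≡-Reasoning
          a = g (suc zero)
          z = g (suc (fromℕ m))
          b = H (y zero ∷ twice g p)
          Σ = ⨁ (λ x → H (y (suc x) ∷ twice g p))
          K = expand (ladder m (g ∘ suc) (y ∘ suc)) H
          Kinv = expand-invariant (ladder m (g ∘ suc) (y ∘ suc)) (invariant s)
          c′ = step-clean (injective s) c
          one : ∀ x → K (g (suc x) ∷ y zero ∷ g zero ∷ g zero ∷ p) ≡ b
          one x = trans (ladder-1 m (tailStrip s) _ (clean-∷ (off s zero ∘ suc) c′) x)
                        (twice-∷ (g ∘ suc) (invariant s) _ _)

  -- Vertex zero takes two of its three edges. If the rung is among them, one end of the remaining
  -- path is charged besides `suc x`, and the two possible ends make up the sum in `ladder-2`. If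
  -- the rung leaves, `suc x` is the only charge and `ladder-1` applies.
  ring-suc : ∀ m {g y H} → Strip {suc m} g y H → ∀ p → Clean g p → ∀ x →
             expand (ring m g (λ x′ → [ y x′ ])) H (g (suc x) ∷ p) ≡
             (⨁ (λ x′ → H (y (suc x′) ∷ twice g p)) xor H (y (suc x) ∷ twice g p))
               xor H (y zero ∷ twice g p)
  ring-suc m {g} {y} {H} s p c x = begin
    _
      ≡⟨ elim₃-0 (tailCapped s) (two s zero) _ (head≢ s zero) (head≢ s (fromℕ m)) (off s zero zero)
           (trans (count-miss p (head≢ s x)) (c zero)) ⟩
    K (g zero ∷ g zero ∷ a ∷ w ∷ p) xor
      (K (g zero ∷ z ∷ g zero ∷ w ∷ p) xor K (y zero ∷ g zero ∷ g zero ∷ w ∷ p))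
      ≡⟨ sym (xor-assoc (K (g zero ∷ g zero ∷ a ∷ w ∷ p)) _ _) ⟩
    (K (g zero ∷ g zero ∷ a ∷ w ∷ p) xor K (g zero ∷ z ∷ g zero ∷ w ∷ p))
      xor K (y zero ∷ g zero ∷ g zero ∷ w ∷ p)
      ≡⟨ cong₂ _xor_
           (trans
             (cong₂ _xor_ (Kinv (↭-trans ↭-third (prep _ ↭-third)))
                          (Kinv (↭-trans (swap _ _ ↭-refl) (prep _ ↭-third))))
             (ladder-2 m (tailStrip s) _ c′ x))
           (trans (Kinv (shift w (y zero ∷ g zero ∷ g zero ∷ []) p))
             (trans (ladder-1 m (tailStrip s) _ (clean-∷ (off s zero ∘ suc) c′) x)
               (twice-∷ (g ∘ suc) (invariant s) _ _))) ⟩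
    _ ∎
    where open ≡-Reasoning
          a = g (suc zero)
          z = g (suc (fromℕ m))
          w = g (suc x)
          K = expand (ladder m (g ∘ suc) (y ∘ suc)) H
          Kinv = expand-invariant (ladder m (g ∘ suc) (y ∘ suc)) (invariant s)
          c′ = step-clean (injective s) c

-- The last row, and induction over the rows

module _ {X : Set} {{_ : Finite X}} where

  count-twice-off : ∀ {n} (g : Fin n → X) {v} → (∀ x → g x ≢ v) → ∀ p →
                  count v (twice g p) ≡ count v p
  count-twice-off {zero}  g g≢v p = refl
  count-twice-off {suc n} g g≢v p = trans (count-twice-off (g ∘ suc) (g≢v ∘ suc) _)
    (trans (count-miss _ (g≢v zero)) (count-miss p (g≢v zero)))

  count-once-off : ∀ {n} (g : Fin n → X) {v} → (∀ x → g x ≢ v) → ∀ p →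
                  count v (once g p) ≡ count v p
  count-once-off {zero}  g g≢v p = refl
  count-once-off {suc n} g g≢v p = trans (count-once-off (g ∘ suc) (g≢v ∘ suc) _) (count-miss p (g≢v zero))

  count-twice : ∀ {n} {g : Fin n → X} → (∀ {x x′} → g x ≡ g x′ → x ≡ x′) → ∀ x p →
              count (g x) (twice g p) ≡ 2 + count (g x) p
  count-twice {g = g} inj zero p = trans (count-twice-off (g ∘ suc) (λ x eq → case inj eq of λ ()) _)
    (trans (count-hit _ _) (cong suc (count-hit _ p)))
  count-twice inj (suc x) p = trans (count-twice (Fin.suc-injective ∘ inj) x _)
    (cong (2 +_) (trans (count-miss _ ne) (count-miss p ne)))
    where ne : _ ≢ _
          ne eq = case inj eq of λ ()

  count-once : ∀ {n} {g : Fin n → X} → (∀ {x x′} → g x ≡ g x′ → x ≡ x′) → ∀ x p →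
              count (g x) (once g p) ≡ 1 + count (g x) p
  count-once {g = g} inj zero p = trans (count-once-off (g ∘ suc) (λ x eq → case inj eq of λ ()) _) (count-hit _ p)
  count-once inj (suc x) p = trans (count-once (Fin.suc-injective ∘ inj) x _)
    (cong suc (count-miss p λ eq → case inj eq of λ ()))

  Injective₂ : ∀ {k n} → (Fin k → Fin n → X) → Set
  Injective₂ G = ∀ {t t′ x x′} → G t x ≡ G t′ x′ → t ≡ t′ × x ≡ x′

  tailInjective₂ : ∀ {k n} {G : Fin (suc k) → Fin n → X} → Injective₂ G → Injective₂ (G ∘ suc)
  tailInjective₂ inj eq = Fin.suc-injective (proj₁ (inj eq)) , proj₂ (inj eq)

  -- Adds to `p` the heads demanded on the whole grid. By `count-final`, a `p` without heads on the
  -- grid then meets every demand there.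
  final : ∀ k {m} → (Fin (suc k) → Fin (suc m) → X) → List X → List X
  final zero    G p = once (G zero ∘ suc) (G zero zero ∷ G zero zero ∷ p)
  final (suc k) G p = final k (G ∘ suc) (twice (G zero) p)

  count-final-off : ∀ k {m} {G : Fin (suc k) → Fin (suc m) → X} {v} → (∀ t x → G t x ≢ v) →
                    ∀ p → count v (final k G p) ≡ count v p
  count-final-off zero {G = G} G≢v p = trans (count-once-off (G zero ∘ suc) (G≢v zero ∘ suc) _)
    (trans (count-miss _ (G≢v zero zero)) (count-miss p (G≢v zero zero)))
  count-final-off (suc k) {G = G} G≢v p =
    trans (count-final-off k (G≢v ∘ suc) _) (count-twice-off (G zero) (G≢v zero) p)

  module _ (cap : X → ℕ) where
    open Elimination cap
    open Strip

    record Loads {k m} (G : Fin (suc k) → Fin (suc m) → X) : Set where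
      field
        below   : ∀ t x → t ≢ fromℕ k → cap (G t x) ≡ 2
        topZero : cap (G (fromℕ k) zero) ≡ 2
        topSuc  : ∀ x → cap (G (fromℕ k) (suc x)) ≡ 1

    tailLoads : ∀ {k m G} → Loads {suc k} {m} G → Loads (G ∘ suc)
    tailLoads l = record
      { below = λ t x ne → below (suc t) x (ne ∘ Fin.suc-injective)
      ; topZero = topZero ; topSuc = topSuc }
      where open Loads l

    count-final : ∀ k {m G} → Injective₂ G → Loads {k} {m} G → ∀ p → (∀ t → Clean (G t) p) →
                  ∀ t x → count (G t x) (final k G p) ≡ cap (G t x)
    count-final zero {G = G} inj l p c zero zero = trans (count-once-off (G zero ∘ suc) (λ x eq → case proj₂ (inj eq) of λ ()) _)
      (trans (trans (count-hit _ _) (cong suc (trans (count-hit _ p) (cong suc (c zero zero)))))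
        (sym (Loads.topZero l)))
    count-final zero inj l p c zero (suc x) =
      trans (count-once (Fin.suc-injective ∘ proj₂ ∘ inj) x _)
        (trans (cong suc (trans (count-miss _ ne) (trans (count-miss p ne) (c zero (suc x)))))
          (sym (Loads.topSuc l x)))
      where ne : _ ≢ _
            ne eq = case proj₂ (inj eq) of λ ()
    count-final (suc k) inj l p c zero x =
      trans (count-final-off k (λ t x′ eq → case proj₁ (inj eq) of λ ()) _)
        (trans (count-twice (proj₂ ∘ inj) x p)
          (trans (cong (2 +_) (c zero x)) (sym (Loads.below l zero x λ ()))))
    count-final (suc k) {G = G} inj l p c (suc t) x =
      count-final k (tailInjective₂ inj) (tailLoads l) _
        (λ t′ x′ → trans (count-twice-off (G zero) (λ x″ eq → case proj₁ (inj eq) of λ ()) p) (c (suc t′) x′)) t x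

    chain : ∀ m → (Fin (suc m) → X) → List (X × X)
    chain m g = fans g (λ x → nexts m g x ++ [])

    chain-avoids : ∀ m {g v} → (∀ x → g x ≢ v) → Avoids v (chain m g)
    chain-avoids m g≢v = fans-avoids g≢v λ x → All.++⁺ (nexts-All m g≢v x) []

    -- One head per vertex, with the charge as the head at `g x`, makes the path a tree rooted at
    -- `g x`: its edges can only be directed away from the root.
    chain-1 : ∀ m {g : Fin (suc m) → X} {H} → (∀ {x x′} → g x ≡ g x′ → x ≡ x′) →
              (∀ x → Capped H (g x)) → (∀ x → cap (g x) ≡ 1) → Invariant H →
              ∀ p → Clean g p → ∀ x → expand (chain m g) H (g x ∷ p) ≡ H (once g p)
    chain-1 zero inj cp one inv p c zero = refl
    chain-1 (suc m) {g} inj cp one inv p c x = trans (head x)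
        (chain-1 m (Fin.suc-injective ∘ inj) (cp ∘ suc) (one ∘ suc) inv _ (clean-∷ ne (c ∘ suc)) _)
      where
      ne : ∀ x → g zero ≢ g (suc x)
      ne x eq = case inj eq of λ ()
      K = expand (chain m (g ∘ suc)) _
      -- The position of the charge in the shorter chain: a charge at `zero` is passed on to the
      -- next vertex, any other charge stays where it is.
      pred′ : Fin (suc (suc m)) → Fin (suc m)
      pred′ zero    = zero
      pred′ (suc x) = x
      cp₀ : Capped K (g zero)
      cp₀ = expand-capped (chain m (g ∘ suc)) (chain-avoids m (λ x → ne x ∘ sym)) (cp zero)
      head : ∀ x → expand (chain (suc m) g) _ (g x ∷ p) ≡ K (g (suc (pred′ x)) ∷ g zero ∷ p)
      head zero    = skip cp₀ _ [] _
        (trans (count-hit _ p) (trans (cong suc (c zero)) (sym (one zero))))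
      head (suc x) = trans
        (take cp₀ _ [] _ ((ne zero ∘ sym) ∷ [])
          (trans (cong (_+ 1) (trans (count-miss p (ne x ∘ sym)) (c zero))) (sym (one zero))))
        (expand-invariant (chain m (g ∘ suc)) inv (swap _ _ ↭-refl))

    record TopRow {m} (g : Fin (2 + m) → X) (H : List X → Bool) : Set where
      field
        injective : ∀ {x x′} → g x ≡ g x′ → x ≡ x′
        capped    : ∀ x → Capped H (g x)
        two       : cap (g zero) ≡ 2
        one       : ∀ x → cap (g (suc x)) ≡ 1
        invariant : Invariant H

    module _ {m} {g : Fin (2 + m) → X} {H} (r : TopRow g H) {p} (c : Clean g p) where
      private
        module R = TopRow r
        K = expand (chain m (g ∘ suc)) H
        ne : ∀ x → g zero ≢ g (suc x)
        ne x eq = case R.injective eq of λ ()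
        cp₀ : Capped K (g zero)
        cp₀ = expand-capped (chain m (g ∘ suc)) (chain-avoids m (λ x → ne x ∘ sym)) (R.capped zero)
        rest : ∀ x → K (g (suc x) ∷ g zero ∷ g zero ∷ p) ≡ H (once (g ∘ suc) (g zero ∷ g zero ∷ p))
        rest = chain-1 m (Fin.suc-injective ∘ R.injective) (R.capped ∘ suc) R.one R.invariant _
                 (step-clean R.injective c)
        Kinv = expand-invariant (chain m (g ∘ suc)) R.invariant

      -- The two cyclic orientations of the ring both meet the demands, and cancel.
      topRow-zero : expand (ring m g (λ _ → [])) H (g zero ∷ p) ≡ false
      topRow-zero = trans
        (elim₂-1 cp₀ R.two _ (ne zero ∘ sym) (ne (fromℕ m) ∘ sym) (trans (count-hit _ p) (cong suc (c zero))))
        (trans (cong₂ _xor_ (trans (Kinv (swap _ _ ↭-refl)) (rest zero)) (rest (fromℕ m)))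
          (xor-same (H (once (g ∘ suc) (g zero ∷ g zero ∷ p)))))

      -- Vertex zero must take both of its edges, and a chain with one charge remains.
      topRow-suc : ∀ x → expand (ring m g (λ _ → [])) H (g (suc x) ∷ p) ≡
                         H (once (g ∘ suc) (g zero ∷ g zero ∷ p))
      topRow-suc x = trans
        (elim₂-0 cp₀ R.two _ (ne zero ∘ sym) (ne (fromℕ m) ∘ sym)
          (trans (count-miss p (ne x ∘ sym)) (c zero)))
        (trans (Kinv ↭-third) (rest x))

    grid-avoids : ∀ k m {G : Fin (suc k) → Fin (2 + m) → X} {v} → (∀ t x → G t x ≢ v) → Avoids v (grid k m G)
    grid-avoids k m {G} {v} G≢v = All.concat⁺ (All.tabulate⁺ λ t →
      fans-avoids (G≢v t) λ x → All.++⁺ (ring-All t x) (nexts-All k (λ t′ → G≢v t′ x) t))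
      where
      ring-All : ∀ t x → All (_≢ v) (ringNexts m (G t) x)
      ring-All t zero    = G≢v t _ ∷ G≢v t _ ∷ []
      ring-All t (suc x) = nexts-All m (G≢v t ∘ suc) x

    -- The hypothesis `even` expresses that `suc m` is even, hence that the ring on `2 + m` vertices
    -- is odd. The values for a defect at `zero` and elsewhere are proved together, since a defect
    -- at `suc x` calls for both of them in the next row.
    grid-odd : ∀ k m {G : Fin (suc k) → Fin (2 + m) → X} → (∀ b → ⨁ {suc m} (λ _ → b) ≡ false) → Injective₂ G → Loads G →
               ∀ {H} → Invariant H → (∀ t x → Capped H (G t x)) →
               ∀ p → (∀ t → Clean (G t) p) →
               expand (grid k m G) H (G zero zero ∷ p) ≡ false ×
               (∀ x → expand (grid k m G) H (G zero (suc x) ∷ p) ≡ H (final k G p))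
    grid-odd zero m {G} even inj l {H} inv cp p c =
      trans (expand-++ row [] H _) (topRow-zero top (c zero)) ,
      λ x → trans (expand-++ row [] H _) (topRow-suc top (c zero) x)
      where
      row = ring m (G zero) (λ _ → [])
      top : TopRow (G zero) H
      top = record
        { injective = proj₂ ∘ inj ; capped = cp zero ; two = Loads.topZero l
        ; one = Loads.topSuc l ; invariant = inv }
    grid-odd (suc k) m {G} even inj l {H} inv cp p c =
      (begin
        expand (grid (suc k) m G) H (G zero zero ∷ p)
          ≡⟨ expand-++ row (grid k m (G ∘ suc)) H _ ⟩
        expand row K (G zero zero ∷ p)
          ≡⟨ ring-zero cap m s p (c zero) ⟩
        ⨁ (λ x → K (G (suc zero) (suc x) ∷ twice (G zero) p))
          ≡⟨ cancel ⟩
        false ∎) ,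
      λ x → begin
        expand (grid (suc k) m G) H (G zero (suc x) ∷ p)
          ≡⟨ expand-++ row (grid k m (G ∘ suc)) H _ ⟩
        expand row K (G zero (suc x) ∷ p)
          ≡⟨ ring-suc cap m s p (c zero) x ⟩
        (⨁ (λ x′ → K (G (suc zero) (suc x′) ∷ twice (G zero) p)) xor
          K (G (suc zero) (suc x) ∷ twice (G zero) p)) xor K (G (suc zero) zero ∷ twice (G zero) p)
          ≡⟨ cong₂ _xor_ (cong₂ _xor_ cancel (proj₂ IH x)) (proj₁ IH) ⟩
        H (final k (G ∘ suc) (twice (G zero) p)) xor false
          ≡⟨ xor-identityʳ _ ⟩
        H (final k (G ∘ suc) (twice (G zero) p)) ∎
      where
      open ≡-Reasoning
      row = ring m (G zero) (λ x → [ G (suc zero) x ])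
      K = expand (grid k m (G ∘ suc)) H
      s : Strip {suc m} (G zero) (G (suc zero)) K
      s = record
        { injective = proj₂ ∘ inj
        ; off = λ x x′ eq → case proj₁ (inj eq) of λ ()
        ; capped = λ x → expand-capped (grid k m (G ∘ suc))
            (grid-avoids k m {G ∘ suc} (λ t x′ eq → case proj₁ (inj eq) of λ ())) (cp zero x)
        ; two = λ x → Loads.below l zero x λ ()
        ; invariant = expand-invariant (grid k m (G ∘ suc)) inv }
      IH = grid-odd k m even (tailInjective₂ inj) (tailLoads l) inv (cp ∘ suc) (twice (G zero) p)
             (λ t x → trans (count-twice-off (G zero) (λ x′ eq → case proj₁ (inj eq) of λ ()) p) (c (suc t) x))
      cancel = trans (⨁-cong (proj₂ IH)) (even (H (final k (G ∘ suc) (twice (G zero) p))))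

-- Circulations modulo 2

isOdd : ℕ → Bool
isOdd zero    = false
isOdd (suc n) = not (isOdd n)

isOdd-+ : ∀ m n → isOdd (m + n) ≡ isOdd m xor isOdd n
isOdd-+ zero    n = refl
isOdd-+ (suc m) n = trans (cong not (isOdd-+ m n)) (not-distribˡ-xor (isOdd m) _)

witness : {P : Set} (P? : Dec P) → does P? ≡ true → P
witness (yes p) _ = p

module _ {A : Set} where

  parity : {P : Pred A 0ℓ} → Decidable P → List A → Bool
  parity P? []       = false
  parity P? (x ∷ xs) = does (P? x) xor parity P? xs

  parity-++ : {P : Pred A 0ℓ} (P? : Decidable P) → ∀ xs ys →
              parity P? (xs ++ ys) ≡ parity P? xs xor parity P? ys
  parity-++ P? []       ys = refl
  parity-++ P? (x ∷ xs) ys = trans (cong (does (P? x) xor_) (parity-++ P? xs ys))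
                                   (sym (xor-assoc (does (P? x)) _ _))

  parity-cong : {P Q : Pred A 0ℓ} (P? : Decidable P) (Q? : Decidable Q) →
                (∀ x → P x ⇔ Q x) → ∀ xs → parity P? xs ≡ parity Q? xs
  parity-cong P? Q? P⇔Q []       = refl
  parity-cong P? Q? P⇔Q (x ∷ xs) =
    cong₂ _xor_ (does-⇔ (P⇔Q x) (P? x) (Q? x)) (parity-cong P? Q? P⇔Q xs)

  isOdd-filter : {P : Pred A 0ℓ} (P? : Decidable P) → ∀ xs →
                 isOdd (length (filter P? xs)) ≡ parity P? xs
  isOdd-filter P? []       = refl
  isOdd-filter P? (x ∷ xs) with does (P? x)
  ... | true  = cong not (isOdd-filter P? xs)
  ... | false = isOdd-filter P? xs

  length-filter-¬ : {P : Pred A 0ℓ} (P? : Decidable P) → ∀ xs →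
    length (filter P? xs) + length (filter (¬? ∘ P?) xs) ≡ length xs
  length-filter-¬ P? []       = refl
  length-filter-¬ P? (x ∷ xs) with does (P? x)
  ... | true  = cong suc (length-filter-¬ P? xs)
  ... | false = trans (ℕ.+-suc _ _) (cong suc (length-filter-¬ P? xs))

parity-map : {A B : Set} {P : Pred B 0ℓ} (P? : Decidable P) (f : A → B) → ∀ xs →
             parity P? (map f xs) ≡ parity (P? ∘ f) xs
parity-map P? f []       = refl
parity-map P? f (x ∷ xs) = cong (does (P? (f x)) xor_) (parity-map P? f xs)

length-filter-map : {A B : Set} {P : Pred B 0ℓ} (P? : Decidable P) (f : A → B) → ∀ xs →
                    length (filter P? (map f xs)) ≡ length (filter (P? ∘ f) xs)
length-filter-map P? f []       = refl
length-filter-map P? f (x ∷ xs) with does (P? (f x))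
... | true  = cong suc (length-filter-map P? f xs)
... | false = length-filter-map P? f xs

module _ {X : Set} {{_ : Finite X}} where

  heads tails : List (X × X) → List X
  heads = map proj₂
  tails = map proj₁

  opaque
    unfolding count

    indegree-count : ∀ E v → indegree E v ≡ count v (heads E)
    indegree-count E v = sym (length-filter-map (_≟ v) proj₂ E)

    outdegree-count : ∀ E v → outdegree E v ≡ count v (tails E)
    outdegree-count E v = sym (length-filter-map (_≟ v) proj₁ E)

    count-[] : ∀ (v : X) → count v [] ≡ 0
    count-[] v = refl

  count-∷ : ∀ (v a : X) p → count v (a ∷ p) ≡ count v (a ∷ []) + count v p
  count-∷ v a p = case a ≟ v of λ where
    (yes refl) → trans (count-hit v p) (cong (_+ count v p)
                     (sym (trans (count-hit v []) (cong suc (count-[] v)))))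
    (no a≢v) → trans (count-miss p a≢v) (cong (_+ count v p)
                     (sym (trans (count-miss [] a≢v) (count-[] v))))

  count-∈ : ∀ v p {n} → count v p ≡ suc n → v ∈ p
  count-∈ v []      eq = case trans (sym (count-[] v)) eq of λ ()
  count-∈ v (a ∷ p) eq = case a ≟ v of λ where
    (yes refl) → here refl
    (no a≢v)     → there (count-∈ v p (trans (sym (count-miss p a≢v)) eq))

  infix 4 _≈_ _≈?_
  _≈_ : List X → List X → Set
  h ≈ t = ∀ v → count v h ≡ count v t

  _≈?_ : ∀ h t → Dec (h ≈ t)
  h ≈? t = all? (λ v → count v h ℕ.≟ count v t)

  ≈⇒↭ : ∀ h t → h ≈ t → h ↭ t
  ≈⇒↭ []      []      eq = ↭-refl
  ≈⇒↭ []      (x ∷ t) eq = case trans (sym (count-[] x)) (trans (eq x) (count-hit x t)) of λ ()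
  ≈⇒↭ (x ∷ h) t       eq with ∈-∃++ (count-∈ x t (trans (sym (eq x)) (count-hit x h)))
  ... | ys , zs , refl = ↭-trans (prep x (≈⇒↭ h (ys ++ zs) h≈)) (↭-sym (shift x ys zs))
    where
    h≈ : h ≈ ys ++ zs
    h≈ v = ℕ.+-cancelˡ-≡ (count v (x ∷ [])) _ _ (begin
      count v (x ∷ []) + count v h          ≡⟨ sym (count-∷ v x h) ⟩
      count v (x ∷ h)                       ≡⟨ eq v ⟩
      count v (ys ++ x ∷ zs)                ≡⟨ count-↭ v (shift x ys zs) ⟩
      count v (x ∷ ys ++ zs)                ≡⟨ count-∷ v x (ys ++ zs) ⟩
      count v (x ∷ []) + count v (ys ++ zs) ∎)
      where open ≡-Reasoning

  -- closures A h t is the parity of the number of subsets E of A for which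
  -- h and the heads of E agree, as multisets, with t and the tails of E.
  closures : List (X × X) → List X → List X → Bool
  closures []            h t = does (h ≈? t)
  closures ((u , v) ∷ A) h t = closures A h t xor closures A (v ∷ h) (u ∷ t)

  closures-cong : ∀ A {h h′ t t′} → h ↭ h′ → t ↭ t′ → closures A h t ≡ closures A h′ t′
  closures-cong [] {h} {h′} {t} {t′} r s = does-⇔ (mk⇔
      (λ eq v → trans (sym (count-↭ v r)) (trans (eq v) (count-↭ v s)))
      (λ eq v → trans (count-↭ v r) (trans (eq v) (sym (count-↭ v s)))))
    (h ≈? t) (h′ ≈? t′)
  closures-cong ((u , v) ∷ A) r s =
    cong₂ _xor_ (closures-cong A r s) (closures-cong A (prep v r) (prep u s))

  -- Needed because `arcs D` lists its arcs in the order of the enumeration of `X`, and not as they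
  -- are constructed.
  closures-↭ : ∀ {A B} → A ↭ B → ∀ h t → closures A h t ≡ closures B h t
  closures-↭ ↭.refl                  h t = refl
  closures-↭ (prep (u , v) r)        h t = cong₂ _xor_ (closures-↭ r h t) (closures-↭ r _ _)
  closures-↭ (swap {xs = A} {ys = B} (u , v) (u′ , v′) r) h t = trans
    (interchange (CommutativeRing.+-commutativeSemigroup xor-∧-commutativeRing)
      (closures A h t) _ _ _)
    (cong₂ _xor_ (cong₂ _xor_ (closures-↭ r h t) (closures-↭ r _ _))
      (cong₂ _xor_ (closures-↭ r _ _)
        (trans (closures-cong A (swap _ _ ↭-refl) (swap _ _ ↭-refl)) (closures-↭ r _ _))))
  closures-↭ (↭.trans r s)           h t = trans (closures-↭ r h t) (closures-↭ s h t)

  closures-parity : ∀ A h t →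
    closures A h t ≡ parity (λ E → (heads E ++ h) ≈? (tails E ++ t)) (sublists A)
  closures-parity []            h t = sym (xor-identityʳ _)
  closures-parity ((u , v) ∷ A) h t = begin
    closures A h t xor closures A (v ∷ h) (u ∷ t)
      ≡⟨ cong₂ _xor_ (closures-parity A h t) (closures-parity A (v ∷ h) (u ∷ t)) ⟩
    parity (test h t) (sublists A) xor parity (test (v ∷ h) (u ∷ t)) (sublists A)
      ≡⟨ cong (parity (test h t) (sublists A) xor_) (sym (trans
           (parity-map (test h t) ((u , v) ∷_) (sublists A))
           (parity-cong (test h t ∘ ((u , v) ∷_)) (test (v ∷ h) (u ∷ t)) (λ E → mk⇔
             (λ eq w → trans (count-↭ w (shift v (heads E) h))
               (trans (eq w) (sym (count-↭ w (shift u (tails E) t)))))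
             (λ eq w → trans (sym (count-↭ w (shift v (heads E) h)))
               (trans (eq w) (count-↭ w (shift u (tails E) t)))))
             (sublists A)))) ⟩
    parity (test h t) (sublists A) xor parity (test h t) (map ((u , v) ∷_) (sublists A))
      ≡⟨ sym (parity-++ (test h t) (sublists A) _) ⟩
    parity (test h t) (sublists A ++ map ((u , v) ∷_) (sublists A)) ∎
    where
    open ≡-Reasoning
    test : ∀ h t E → Dec ((heads E ++ h) ≈ (tails E ++ t))
    test h t E = (heads E ++ h) ≈? (tails E ++ t)

  closures-balanced : ∀ A → closures A [] [] ≡ parity balanced? (sublists A)
  closures-balanced A = trans (closures-parity A [] [])
    (parity-cong (λ E → (heads E ++ []) ≈? (tails E ++ [])) balanced? (λ E → mk⇔
      (λ eq v → trans (in′ E v) (trans (eq v) (sym (out′ E v))))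
      (λ eq v → trans (sym (in′ E v)) (trans (eq v) (out′ E v)))) (sublists A))
    where
    in′ : ∀ E v → indegree E v ≡ count v (heads E ++ [])
    in′ E v = trans (indegree-count E v) (cong (count v) (sym (++-identityʳ _)))
    out′ : ∀ E v → outdegree E v ≡ count v (tails E ++ [])
    out′ E v = trans (outdegree-count E v) (cong (count v) (sym (++-identityʳ _)))

  odd⇒even≢odd : (D : Digraph X) → closures (arcs D) [] [] ≡ true →
                 #evenCirculations D ≢ #oddCirculations D
  odd⇒even≢odd D odd eq = case trans (sym odd) even of λ ()
    where
    open ≡-Reasoning
    C = circulations D
    even : closures (arcs D) [] [] ≡ false
    even = begin
      closures (arcs D) [] []
        ≡⟨ closures-balanced (arcs D) ⟩
      parity balanced? (sublists (arcs D))
        ≡⟨ sym (isOdd-filter balanced? (sublists (arcs D))) ⟩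
      isOdd (length C)
        ≡⟨ cong isOdd (sym (length-filter-¬ (even? ∘ length) C)) ⟩
      isOdd (#evenCirculations D + #oddCirculations D)
        ≡⟨ isOdd-+ (#evenCirculations D) (#oddCirculations D) ⟩
      isOdd (#evenCirculations D) xor isOdd (#oddCirculations D)
        ≡⟨ cong (λ n → isOdd n xor isOdd (#oddCirculations D)) eq ⟩
      isOdd (#oddCirculations D) xor isOdd (#oddCirculations D)
        ≡⟨ xor-same (isOdd (#oddCirculations D)) ⟩
      false ∎

  module _ (w : X → ℕ) where

    weight : List X → ℕ
    weight p = sum (map w p)

    -- No arc has a head lighter than its tail, so the heads stay strictly heavier than the tails
    -- whichever arcs are selected.
    closures-light : ∀ A {h t} → All (λ (u , v) → w u ≤ w v) A → weight t < weight h →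
                     closures A h t ≡ false
    closures-light [] {h} {t} [] lt = dec-false (h ≈? t)
      (λ eq → ℕ.<⇒≢ lt (sym (sum-↭ (↭.map⁺ w (≈⇒↭ h t eq)))))
    closures-light ((u , v) ∷ A) (le ∷ les) lt =
      cong₂ _xor_ (closures-light A les lt) (closures-light A les (ℕ.+-mono-≤-< le lt))

    -- An arc along which the weight increases lies on no circulation, provided
    -- that the weight decreases along no arc.
    closures-drop : ∀ C A {h t} → All (λ (u , v) → w u < w v) C →
                    All (λ (u , v) → w u ≤ w v) A → weight t ≡ weight h →
                    closures (C ++ A) h t ≡ closures A h t
    closures-drop []            A []         les eq = refl
    closures-drop ((u , v) ∷ C) A (lt ∷ lts) les eq = trans
      (cong₂ _xor_ (closures-drop C A lts les eq)
        (closures-light (C ++ A) (All.++⁺ (All.map ℕ.<⇒≤ lts) les) (ℕ.+-mono-<-≤ lt (ℕ.≤-reflexive eq))))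
      (xor-identityʳ _)

  -- From an odd expansion to an orientation

  Flip : X × X → X × X → Set
  Flip e a = a ≡ e ⊎ a ≡ Product.swap e

  expand-flip : ∀ {L A} → Pointwise Flip L A → ∀ {H} p → expand L H p ≡ expand A H p
  expand-flip []                   p = refl
  expand-flip (inj₁ refl ∷ fs) p = cong₂ _xor_ (expand-flip fs _) (expand-flip fs _)
  expand-flip {_ ∷ L} {_ ∷ A} (inj₂ refl ∷ fs) {H} p =
    trans (xor-comm (expand L H _) _) (cong₂ _xor_ (expand-flip fs _) (expand-flip fs _))

  -- A sum modulo 2 equal to 1 has a nonzero term, and following that term fixes a direction for
  -- each edge.
  choose : ∀ L {H} → Invariant H → ∀ p → expand L H p ≡ true →
           ∃[ A ] Pointwise Flip L A × H (heads A ++ p) ≡ true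
  choose []            inv p eq = [] , [] , eq
  choose ((u , v) ∷ L) {H} inv p eq with expand L H (v ∷ p) in eqᵥ
  ... | true  with A , fs , ok ← choose L inv (v ∷ p) eqᵥ =
    (u , v) ∷ A , inj₁ refl ∷ fs , trans (inv (↭-sym (shift v (heads A) p))) ok
  ... | false with A , fs , ok ← choose L inv (u ∷ p) eq =
    (v , u) ∷ A , inj₂ refl ∷ fs , trans (inv (↭-sym (shift u (heads A) p))) ok

  module _ (cap : X → ℕ) where

    meets? : ∀ p → Dec (∀ v → count v p ≡ cap v)
    meets? p = all? (λ v → count v p ℕ.≟ cap v)

    opaque

      meets : List X → Bool
      meets p = does (meets? p)

      meets-does : ∀ p → meets p ≡ does (meets? p)
      meets-does p = refl

      meets-invariant : Invariant meets
      meets-invariant {p} {q} r = does-⇔ (mk⇔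
        (λ eq v → trans (sym (count-↭ v r)) (eq v))
        (λ eq v → trans (count-↭ v r) (eq v))) (meets? p) (meets? q)

      meets-capped : ∀ v → Elimination.Capped cap meets v
      meets-capped v p ne = dec-false (meets? p) (λ eq → ne (eq v))

    -- The choices of heads for A with the in-degrees of A itself
    -- are the reversals of the circulations of A.
    expand-closures : ∀ A p h t x →
      (∀ v → count v p + count v h ≡ count v x + count v t) →
      (∀ v → cap v ≡ count v (heads A) + count v x) →
      expand A meets p ≡ closures A h t
    expand-closures [] p h t x bal load = trans (meets-does p) (does-⇔ (mk⇔
        (λ ok v → ℕ.+-cancelˡ-≡ (count v x) _ _
          (trans (cong (_+ count v h) (sym (trans (ok v) (load′ v)))) (bal v)))
        (λ eq v → trans (ℕ.+-cancelʳ-≡ (count v h) _ _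
          (trans (bal v) (cong (count v x +_) (sym (eq v))))) (sym (load′ v))))
      (meets? p) (h ≈? t))
      where
      load′ : ∀ v → cap v ≡ count v x
      load′ v = trans (load v) (cong (_+ count v x) (count-[] v))
    expand-closures ((a , b) ∷ A) p h t x bal load = cong₂ _xor_
      -- `x` collects the heads of the arcs passed so far as they stand in `A`. An arc that is kept
      -- adds its head to `p` and to `x`; a reversed one adds its tail to `p`, its head to `x`, and
      -- both ends to `h` and `t`, so the balance persists.
      (expand-closures A (b ∷ p) h t (b ∷ x) (λ v → begin
        count v (b ∷ p) + count v h               ≡⟨ cong (_+ _) (count-∷ v b p) ⟩
        (count v (b ∷ []) + count v p) + count v h  ≡⟨ ℕ.+-assoc (count v (b ∷ [])) _ _ ⟩
        count v (b ∷ []) + (count v p + count v h)  ≡⟨ cong (count v (b ∷ []) +_) (bal v) ⟩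
        count v (b ∷ []) + (count v x + count v t)  ≡⟨ sym (ℕ.+-assoc (count v (b ∷ [])) _ _) ⟩
        (count v (b ∷ []) + count v x) + count v t  ≡⟨ cong (_+ _) (sym (count-∷ v b x)) ⟩
        count v (b ∷ x) + count v t ∎) load′)
      (expand-closures A (a ∷ p) (b ∷ h) (a ∷ t) (b ∷ x) (λ v → begin
        count v (a ∷ p) + count v (b ∷ h)
          ≡⟨ cong₂ _+_ (count-∷ v a p) (count-∷ v b h) ⟩
        (count v (a ∷ []) + count v p) + (count v (b ∷ []) + count v h)
          ≡⟨ shuffle (count v (a ∷ [])) (count v p) (count v (b ∷ [])) (count v h) ⟩
        (count v (a ∷ []) + count v (b ∷ [])) + (count v p + count v h)
          ≡⟨ cong ((count v (a ∷ []) + count v (b ∷ [])) +_) (bal v) ⟩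
        (count v (a ∷ []) + count v (b ∷ [])) + (count v x + count v t)
          ≡⟨ shuffle′ (count v (a ∷ [])) (count v (b ∷ [])) (count v x) (count v t) ⟩
        (count v (b ∷ []) + count v x) + (count v (a ∷ []) + count v t)
          ≡⟨ sym (cong₂ _+_ (count-∷ v b x) (count-∷ v a t)) ⟩
        count v (b ∷ x) + count v (a ∷ t) ∎) load′)
      where
      open ≡-Reasoning
      shuffle : ∀ a b c d → (a + b) + (c + d) ≡ (a + c) + (b + d)
      shuffle = solve-∀
      shuffle′ : ∀ a b c d → (a + b) + (c + d) ≡ (b + c) + (a + d)
      shuffle′ = solve-∀
      move : ∀ d m n → (d + m) + n ≡ m + (d + n)
      move = solve-∀
      load′ : ∀ v → cap v ≡ count v (heads A) + count v (b ∷ x)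
      load′ v = trans (load v) (trans (cong (_+ count v x) (count-∷ v b (heads A)))
        (trans (move (count v (b ∷ [])) (count v (heads A)) (count v x))
          (cong (count v (heads A) +_) (sym (count-∷ v b x)))))

  count-++ : ∀ v p q → count v (p ++ q) ≡ count v p + count v q
  count-++ v []      q = cong (_+ count v q) (sym (count-[] v))
  count-++ v (a ∷ p) q = trans (count-∷ v a (p ++ q)) (trans (cong (count v (a ∷ []) +_) (count-++ v p q))
    (trans (sym (ℕ.+-assoc (count v (a ∷ [])) _ _)) (cong (_+ count v q) (sym (count-∷ v a p)))))

  -- A nonzero term of the expansion is an orientation `A` whose heads together with `p` meet `cap`.
  -- The expansion does not change when `L` is replaced by `A`, and then counts the circulations of
  -- `A`. The heads alone are only bounded by `cap`, as `p` uses up a part of it.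
  odd-orientation : ∀ cap L p → expand L (meets cap) p ≡ true →
    ∃[ A ] Pointwise Flip L A × (∀ v → count v (heads A) ≤ cap v) × closures A [] [] ≡ true
  odd-orientation cap L p odd with A , fs , ok ← choose L (meets-invariant cap) p odd =
    A , fs , (λ v → ℕ.≤-trans (ℕ.m≤m+n _ _) (ℕ.≤-reflexive (sym (load v)))) ,
    trans (sym (expand-closures cap A p [] [] p (λ v → refl) load))
      (trans (sym (expand-flip fs p)) odd)
    where
    load : ∀ v → cap v ≡ count v (heads A) + count v p
    load v = trans
      (sym (witness (meets? cap (heads A ++ p)) (trans (sym (meets-does cap _)) ok) v))
      (count-++ v (heads A) p)

-- Orientations as lists of arcs, and the existence of the Alon-Tarsi number

module _ {A : Set} where

  unique-↭ : {xs ys : List A} → Unique xs → Unique ys → (∀ {x} → x ∈ xs ⇔ x ∈ ys) → xs ↭ ys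
  unique-↭ u v eq = ∼bag⇒↭ (unique∧set⇒bag u v eq)

  unique-length-≤ : {xs ys : List A} → Unique xs → xs ⊆ ys → length xs ≤ length ys
  unique-length-≤ [] _ = z≤n
  unique-length-≤ {x ∷ xs} (x∉ ∷ u) sub with ∈-∃++ (sub (here refl))
  ... | as , bs , refl = ℕ.≤-trans
    (s≤s (unique-length-≤ u λ {y} y∈ → case ∈-resp-↭ (shift x as bs) (sub (there y∈)) of λ where
      (here y≡x) → contradiction (sym y≡x) (All.lookup x∉ y∈)
      (there y∈′) → y∈′))
    (ℕ.≤-reflexive (sym (↭-length (shift x as bs))))

  filter-∈-sublists : {P : Pred A 0ℓ} (P? : Decidable P) → ∀ xs → filter P? xs ∈ sublists xs
  filter-∈-sublists P? []       = here refl
  filter-∈-sublists P? (x ∷ xs) with does (P? x)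
  ... | true  = ∈-++⁺ʳ (sublists xs) (∈-map⁺ (x ∷_) (filter-∈-sublists P? xs))
  ... | false = ∈-++⁺ˡ (filter-∈-sublists P? xs)

least : {P : Pred ℕ 0ℓ} → Decidable P → ∀ k → P k → ∃[ a ] (P a × (∀ {j} → P j → a ≤ j) × a ≤ k)
least {P} P? = <-rec _ λ k rec Pk → case ℕ.anyUpTo? P? k of λ where
  (yes (j , j<k , Pj)) → case rec j<k Pj of λ where
    (a , Pa , min , a≤j) → a , Pa , min , ℕ.≤-trans a≤j (ℕ.<⇒≤ j<k)
  (no ¬P) → k , Pk , (λ {j} Pj → ℕ.≮⇒≥ λ j<k → ¬P (j , j<k , Pj)) , ℕ.≤-refl

module _ {X : Set} {{F : Finite X}} where

  ∈-vertices : ∀ (v : X) → v ∈ vertices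
  ∈-vertices v = subst (_∈ vertices) (Inverse.strictlyInverseʳ (Finite.enumeration F) v)
    (∈-map⁺ (Finite.unindex F) (∈-allFin (Finite.index F v)))

  vertices-unique : Unique (vertices {X})
  vertices-unique = Unique.map⁺ inj (Unique.allFin⁺ _)
    where
    inj : ∀ {i j} → Finite.unindex F i ≡ Finite.unindex F j → i ≡ j
    inj {i} {j} eq = trans (sym (Inverse.strictlyInverseˡ (Finite.enumeration F) i))
      (trans (cong (Finite.index F) eq) (Inverse.strictlyInverseˡ (Finite.enumeration F) j))

  pairs : List (X × X)
  pairs = cartesianProduct vertices vertices

  ∈-pairs : ∀ e → e ∈ pairs
  ∈-pairs (u , v) = ∈-cartesianProduct⁺ (∈-vertices u) (∈-vertices v)

  ∈-arcs⁺ : ∀ D {u v : X} → Arc D u v → (u , v) ∈ arcs D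
  ∈-arcs⁺ D {u} {v} a = ∈-filter⁺ (λ (u , v) → arc? D u v) (∈-pairs (u , v)) a

  ∈-arcs⁻ : ∀ D {u v : X} → (u , v) ∈ arcs D → Arc D u v
  ∈-arcs⁻ D a = proj₂ (∈-filter⁻ (λ (u , v) → arc? D u v) {xs = pairs} a)

  arcs-unique : ∀ (D : Digraph X) → Unique (arcs D)
  arcs-unique D = Unique.filter⁺ _ (Unique.cartesianProduct⁺ vertices-unique vertices-unique)

  -- The condition `u ≢ v` turns every list into a digraph, so that arbitrary sublists of `pairs`
  -- can be tested.
  ofList : List (X × X) → Digraph X
  ofList L = record
    { Arc        = λ u v → u ≢ v × (u , v) ∈ L
    ; arc?       = λ u v → ¬? (u ≟ v) ×-dec any? ((u , v) ≟_) L
    ; arc-irrefl = λ eq (ne , _) → ne eq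
    }

  arcs-ofList : ∀ {L} → Unique L → All (λ (u , v) → u ≢ v) L → arcs (ofList L) ↭ L
  arcs-ofList {L} u irr = unique-↭ (arcs-unique (ofList L)) u (mk⇔
    (proj₂ ∘ ∈-arcs⁻ (ofList L))
    (λ e∈ → ∈-arcs⁺ (ofList L) (All.lookup irr e∈ , e∈)))

  arcs-ofList-arcs : ∀ D → arcs (ofList (arcs D)) ≡ arcs D
  arcs-ofList-arcs D = filter-≐ (λ (u , v) → arc? (ofList (arcs D)) u v) (λ (u , v) → arc? D u v)
    ( (λ (_ , e∈) → ∈-arcs⁻ D e∈)
    , (λ a → (λ eq → arc-irrefl D eq a) , ∈-arcs⁺ D a)) pairs

  isOrientation? : ∀ D (G : Graph X) → Dec (IsOrientation D G)
  isOrientation? D G = map′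
    (λ (f , g , h) → record { arc⇒adj = f _ _ ; adj⇒arc = g _ _ ; one-way = h _ _ })
    (λ o → let open IsOrientation o in
      (λ _ _ → arc⇒adj) , (λ _ _ → adj⇒arc) , (λ _ _ → one-way))
    (all? (λ u → all? λ v → arc? D u v →-dec adj? G u v) ×-dec
     all? (λ u → all? λ v → adj? G u v →-dec (arc? D u v ⊎-dec arc? D v u)) ×-dec
     all? (λ u → all? λ v → arc? D u v →-dec ¬? (arc? D v u)))

  module _ (G : Graph X) where

    Witness : ℕ → List (X × X) → Set
    Witness k L = IsOrientation (ofList L) G × suc (maxIndegree (ofList L)) ≡ k ×
                  #evenCirculations (ofList L) ≢ #oddCirculations (ofList L)

    witness? : ∀ k → Decidable (Witness k)
    witness? k L = isOrientation? (ofList L) G ×-dec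
      (suc (maxIndegree (ofList L)) ℕ.≟ k) ×-dec
      ¬? (#evenCirculations (ofList L) ℕ.≟ #oddCirculations (ofList L))

    -- A decidable substitute for `AlonTarsiOrientation`, which quantifies over arbitrary arc
    -- relations. Every digraph is represented by its list of arcs, a sublist of `pairs`, so the
    -- least value can be found by a finite search.
    WitnessAmongSublists : ℕ → Set
    WitnessAmongSublists k = Any (Witness k) (sublists pairs)

    fromOrientation : ∀ {k} → AlonTarsiOrientation G k → WitnessAmongSublists k
    fromOrientation {k} (D , o , size , ne) = lose (filter-∈-sublists (λ (u , v) → arc? D u v) pairs)
      ( record
          { arc⇒adj = λ (_ , e∈) → arc⇒adj (∈-arcs⁻ D e∈)
          ; adj⇒arc = λ a → Sum.map back back (adj⇒arc a)
          ; one-way = λ (_ , e∈) (_ , e∈′) → one-way (∈-arcs⁻ D e∈) (∈-arcs⁻ D e∈′) }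
      , subst (λ A → suc (max 0 (map (indegree A) vertices)) ≡ k) (sym (arcs-ofList-arcs D)) size
      , subst (λ A → length (filter (even? ∘ length) (filter balanced? (sublists A))) ≢
                     length (filter (odd? ∘ length) (filter balanced? (sublists A))))
          (sym (arcs-ofList-arcs D)) ne )
      where
      open IsOrientation o
      back : ∀ {u v} → Arc D u v → Arc (ofList (arcs D)) u v
      back a = (λ eq → arc-irrefl D eq a) , ∈-arcs⁺ D a

    alonTarsiNumber : ∀ {k} → AlonTarsiOrientation G k → ∃[ a ] (IsAlonTarsiNumber G a × a ≤ k)
    alonTarsiNumber {k} w =
      let a , among , min , a≤k = least (λ j → any? (witness? j) (sublists pairs)) k (fromOrientation w)
          L , _ , L-witness     = find among
      in  a , ((ofList L , L-witness) , min ∘ fromOrientation) , a≤k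

  maxIndegree≤ : ∀ (D : Digraph X) {b} → (∀ v → indegree (arcs D) v ≤ b) → maxIndegree D ≤ b
  maxIndegree≤ D le = max≤v⁺ {xs = map (indegree (arcs D)) vertices} z≤n (All.map⁺ {xs = vertices} (All.tabulate λ {v} _ → le v))

-- Members of the edge list of a grid

module _ {X : Set} where

  ∈-fans⁺ : ∀ {n} (g : Fin n → X) forward x {w} → w ∈ forward x → (g x , w) ∈ fans g forward
  ∈-fans⁺ g forward x w∈ = ∈-concat⁺′ (∈-map⁺ (g x ,_) w∈)
    (∈-tabulate⁺ {f = λ x → map (g x ,_) (forward x)} x)

  ∈-fans⁻ : ∀ {n} (g : Fin n → X) forward {e} → e ∈ fans g forward →
            ∃[ x ] ∃[ w ] (w ∈ forward x × e ≡ (g x , w))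
  ∈-fans⁻ g forward e∈ with ∈-concat⁻′ (tabulate λ x → map (g x ,_) (forward x)) e∈
  ... | _ , e∈l , l∈ with x , refl ← ∈-tabulate⁻ {f = λ x → map (g x ,_) (forward x)} l∈ with w , w∈ , refl ← ∈-map⁻ (g x ,_) e∈l =
    x , w , w∈ , refl

  fans-unique : ∀ {n} {g : Fin n → X} {forward} → (∀ {x x′} → g x ≡ g x′ → x ≡ x′) →
                (∀ x → Unique (forward x)) → Unique (fans g forward)
  fans-unique {g = g} {forward} inj u = Unique.concat⁺
    (All.tabulate⁺ λ x → Unique.map⁺ (cong proj₂) (u x))
    (AllPairs.tabulate⁺ λ {x} {x′} x≢x′ (e∈ , e∈′) → case ∈-map⁻ (g x ,_) e∈ of λ where
      (_ , _ , refl) → case ∈-map⁻ (g x′ ,_) e∈′ of λ where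
        (_ , _ , eq) → x≢x′ (inj (cong proj₁ eq)))

  ∈-nexts⁺ : ∀ k (g : Fin (suc k) → X) {t t′} → toℕ t′ ≡ suc (toℕ t) → g t′ ∈ nexts k g t
  ∈-nexts⁺ zero    g {zero}  {zero} ()
  ∈-nexts⁺ (suc k) g {zero}  {suc zero} eq = here refl
  ∈-nexts⁺ (suc k) g {suc t} {suc t′} eq = ∈-nexts⁺ k (g ∘ suc) (ℕ.suc-injective eq)

  ∈-nexts⁻ : ∀ k (g : Fin (suc k) → X) t {w} → w ∈ nexts k g t →
             ∃[ t′ ] (toℕ t′ ≡ suc (toℕ t) × w ≡ g t′)
  ∈-nexts⁻ (suc k) g zero    (here refl) = suc zero , refl , refl
  ∈-nexts⁻ (suc k) g (suc t) w∈ with t′ , eq , eq′ ← ∈-nexts⁻ k (g ∘ suc) t w∈ =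
    suc t′ , cong suc eq , eq′

  nexts-unique : ∀ k (g : Fin (suc k) → X) t → Unique (nexts k g t)
  nexts-unique zero    g t       = []
  nexts-unique (suc k) g zero    = [] ∷ []
  nexts-unique (suc k) g (suc t) = nexts-unique k (g ∘ suc) t

-- The edges in coordinates, directed as `grid` lists them; thus `wrap` starts at `zero`.
data Link {k m} : (t : Fin (suc k)) (x : Fin (2 + m)) (t′ : Fin (suc k)) (x′ : Fin (2 + m)) → Set where
  up   : ∀ {t t′ x} → toℕ t′ ≡ suc (toℕ t) → Link t x t′ x
  step : ∀ {t x x′} → toℕ x′ ≡ suc (toℕ x) → Link t x t x′
  wrap : ∀ {t} → Link t zero t (fromℕ (suc m))

-- The coordinate sum serves as a rank that increases along every listed edge, so no edge is listed
-- in both directions.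
link-< : ∀ {k m t x t′ x′} → Link {k} {m} t x t′ x′ → toℕ t + toℕ x < toℕ t′ + toℕ x′
link-< (up {x = x} eq)   = ℕ.≤-reflexive (cong (_+ toℕ x) (sym eq))
link-< (step {t} eq) = ℕ.+-monoʳ-< (toℕ t) (ℕ.≤-reflexive (sym eq))
link-< (wrap {t})    = ℕ.+-monoʳ-< (toℕ t) (s≤s z≤n)

module _ {X : Set} where

  module _ k m (G : Fin (suc k) → Fin (2 + m) → X) where

    private
      forward : Fin (suc k) → Fin (2 + m) → List X
      forward t x = ringNexts m (G t) x ++ nexts k (λ t′ → G t′ x) t

    ∈-grid⁺ : ∀ {t x t′ x′} → Link t x t′ x′ → (G t x , G t′ x′) ∈ grid k m G
    ∈-grid⁺ {t} {x} {t′} {x′} l = ∈-concat⁺′ (∈-fans⁺ (G t) (forward t) x (target l))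
      (∈-tabulate⁺ {f = λ t → fans (G t) (forward t)} t)
      where
      target : ∀ {t x t′ x′} → Link t x t′ x′ → G t′ x′ ∈ forward t x
      target {t} {x} (up eq) = ∈-++⁺ʳ (ringNexts m (G t) x) (∈-nexts⁺ k (λ t′ → G t′ x) eq)
      target {t} {zero}  {x′ = suc zero} (step eq) = here refl
      target {t} {suc x} {x′ = suc x′}   (step eq) =
        ∈-++⁺ˡ (∈-nexts⁺ m (G t ∘ suc) (ℕ.suc-injective eq))
      target wrap = there (here refl)

    ∈-grid⁻ : ∀ {e} → e ∈ grid k m G →
              ∃[ t ] ∃[ x ] ∃[ t′ ] ∃[ x′ ] (Link t x t′ x′ × e ≡ (G t x , G t′ x′))
    ∈-grid⁻ e∈ with ∈-concat⁻′ (tabulate λ t → fans (G t) (forward t)) e∈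
    ... | _ , e∈l , l∈ with t , refl ← ∈-tabulate⁻ {f = λ t → fans (G t) (forward t)} l∈
      with x , w , w∈ , refl ← ∈-fans⁻ (G t) (forward t) e∈l = t , x , target x (∈-++⁻ (ringNexts m (G t) x) w∈)
      where
      target : ∀ x {w} → w ∈ ringNexts m (G t) x ⊎ w ∈ nexts k (λ t′ → G t′ x) t →
               ∃[ t′ ] ∃[ x′ ] (Link t x t′ x′ × (G t x , w) ≡ (G t x , G t′ x′))
      target zero    (inj₁ (here refl))         = t , _ , step refl , refl
      target zero    (inj₁ (there (here refl))) = t , _ , wrap , refl
      target (suc x) (inj₁ w∈) with x′ , eq , refl ← ∈-nexts⁻ m (G t ∘ suc) x w∈ =
        t , suc x′ , step (cong suc eq) , refl
      target x (inj₂ w∈) with t′ , eq , refl ← ∈-nexts⁻ k (λ t′ → G t′ x) t w∈ =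
        t′ , x , up eq , refl

  -- Rings have at least three vertices here: on two, the closing edge would repeat the first one.
  grid-unique : ∀ k m {G : Fin (suc k) → Fin (3 + m) → X} →
                (∀ {t t′ x x′} → G t x ≡ G t′ x′ → t ≡ t′ × x ≡ x′) → Unique (grid k (suc m) G)
  grid-unique k m {G} inj = Unique.concat⁺
    (All.tabulate⁺ λ t → fans-unique (λ eq → proj₂ (inj {t} {t} eq)) λ x →
      Unique.++⁺ (ring-unique t x) (nexts-unique k (λ t′ → G t′ x) t) (rows≢ t x))
    (AllPairs.tabulate⁺ λ {t} {t′} t≢t′ (e∈ , e∈′) →
      case ∈-fans⁻ (G t) (forward t) e∈ of λ where
        (_ , _ , _ , refl) → case ∈-fans⁻ (G t′) (forward t′) e∈′ of λ where
          (_ , _ , _ , eq) → t≢t′ (proj₁ (inj (cong proj₁ eq))))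
    where
    forward : Fin (suc k) → Fin (3 + m) → List X
    forward t x = ringNexts (suc m) (G t) x ++ nexts k (λ t′ → G t′ x) t
    ring-unique : ∀ t x → Unique (ringNexts (suc m) (G t) x)
    ring-unique t zero    = ((λ eq → case proj₂ (inj {t} {t} eq) of λ ()) ∷ []) ∷ ([] ∷ [])
    ring-unique t (suc x) = nexts-unique (suc m) (G t ∘ suc) x
    inRow : ∀ t x → All (λ w → ∃[ x′ ] w ≡ G t x′) (ringNexts (suc m) (G t) x)
    inRow t zero    = (_ , refl) ∷ (_ , refl) ∷ []
    inRow t (suc x) = nexts-All (suc m) (λ x′ → suc x′ , refl) x
    rows≢ : ∀ t x → Disjoint (ringNexts (suc m) (G t) x) (nexts k (λ t′ → G t′ x) t)
    rows≢ t x (w∈ , w∈′) with x′ , refl ← All.lookup (inRow t x) w∈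
      with t′ , eq , eq′ ← ∈-nexts⁻ k (λ t′ → G t′ x) t w∈′ =
      ℕ.1+n≢n (trans (sym eq) (cong toℕ (sym (proj₁ (inj {t} {t′} eq′)))))

-- Reversing edges of a list

module _ {X : Set} {{_ : Finite X}} where

  flip-∈⁻ : ∀ {L A} → Pointwise Flip L A → ∀ {u v : X} → (u , v) ∈ A → (u , v) ∈ L ⊎ (v , u) ∈ L
  flip-∈⁻ (inj₁ refl ∷ fs) (here refl) = inj₁ (here refl)
  flip-∈⁻ (inj₂ refl ∷ fs) (here refl) = inj₂ (here refl)
  flip-∈⁻ (_ ∷ fs)         (there e∈)  = Sum.map there there (flip-∈⁻ fs e∈)

  flip-∈⁺ : ∀ {L A} → Pointwise Flip L A → ∀ {u v : X} → (u , v) ∈ L → (u , v) ∈ A ⊎ (v , u) ∈ A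
  flip-∈⁺ (inj₁ refl ∷ fs) (here refl) = inj₁ (here refl)
  flip-∈⁺ (inj₂ refl ∷ fs) (here refl) = inj₂ (here refl)
  flip-∈⁺ (_ ∷ fs)         (there e∈)  = Sum.map there there (flip-∈⁺ fs e∈)

  module _ (rank : X → ℕ) where

    -- Recovers the listed form of an edge from either direction. Sorting a reorientation of an
    -- ascending list gives the list back, and this transfers uniqueness.
    sorted : X × X → X × X
    sorted (u , v) = if does (rank u ℕ.<? rank v) then (u , v) else (v , u)

    Ascending : X × X → Set
    Ascending (u , v) = rank u < rank v

    ordered : ∀ {u v} → Ascending (u , v) → sorted (u , v) ≡ (u , v)
    ordered {u} {v} lt = cong (if_then (u , v) else (v , u)) (dec-true (rank u ℕ.<? rank v) lt)

    reversed : ∀ {u v} → Ascending (u , v) → sorted (v , u) ≡ (u , v)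
    reversed {u} {v} lt =
      cong (if_then (v , u) else (u , v)) (dec-false (rank v ℕ.<? rank u) (ℕ.<-asym lt))

    sorted-flip : ∀ {L A} → Pointwise Flip L A → All Ascending L → map sorted A ≡ L
    sorted-flip []                 []         = refl
    sorted-flip (inj₁ refl ∷ fs) (lt ∷ lts) = cong₂ _∷_ (ordered lt) (sorted-flip fs lts)
    sorted-flip (inj₂ refl ∷ fs) (lt ∷ lts) = cong₂ _∷_ (reversed lt) (sorted-flip fs lts)

    sorted-swap : ∀ {u v} → rank u ≢ rank v → sorted (u , v) ≡ sorted (v , u)
    sorted-swap {u} {v} ne = case ℕ.<-cmp (rank u) (rank v) of λ where
        (tri< lt _ _) → trans (ordered lt) (sym (reversed lt))
        (tri≈ _ eq _) → contradiction eq ne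
        (tri> _ _ gt) → trans (reversed gt) (sym (ordered gt))

    flip-unique : ∀ {L A} → Pointwise Flip L A → All Ascending L → Unique L → Unique A
    flip-unique fs asc u = Unique.map⁻ {f = sorted} (subst Unique (sym (sorted-flip fs asc)) u)

    flip-ranks : ∀ {L A} → Pointwise Flip L A → All Ascending L →
                 ∀ {u v} → (u , v) ∈ A → rank u ≢ rank v
    flip-ranks fs asc e∈ eq with flip-∈⁻ fs e∈
    ... | inj₁ e∈L = ℕ.<⇒≢ (All.lookup asc e∈L) eq
    ... | inj₂ e∈L = ℕ.<⇒≢ (All.lookup asc e∈L) (sym eq)

    -- Opposite arcs sort to the same edge. As `map sorted A` is the list `L` without repetitions,
    -- they would be equal, and the two ends would have equal rank.
    flip-one-way : ∀ {L A} → Pointwise Flip L A → All Ascending L → Unique L →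
                   ∀ {u v} → (u , v) ∈ A → ¬ (v , u) ∈ A
    flip-one-way {L} {A} fs asc u e∈ e∈′ = flip-ranks fs asc e∈ (cong (rank ∘ proj₁)
        (injectiveOn (subst Unique (sym (sorted-flip fs asc)) u) e∈ e∈′ (sorted-swap (flip-ranks fs asc e∈))))
      where
      injectiveOn : ∀ {as} → Unique (map sorted as) → ∀ {a b} → a ∈ as → b ∈ as →
                    sorted a ≡ sorted b → a ≡ b
      injectiveOn (_ ∷ _)  (here refl) (here refl) eq = refl
      injectiveOn (new ∷ _)  (here refl) (there b∈)  eq = contradiction eq (All.lookup new (∈-map⁺ sorted b∈))
      injectiveOn (new ∷ _)  (there a∈)  (here refl) eq = contradiction (sym eq) (All.lookup new (∈-map⁺ sorted a∈))
      injectiveOn (_ ∷ us) (there a∈)  (there b∈)  eq = injectiveOn us a∈ b∈ eq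

-- Adding the arcs between levels

module _ {X : Set} {{_ : Finite X}} (P : Graph X) (level : X → ℕ) where

  Crossing : X × X → Set
  Crossing (u , v) = Adj P u v × level u < level v

  crossing? : ∀ e → Dec (Crossing e)
  crossing? (u , v) = adj? P u v ×-dec (level u ℕ.<? level v)

  opaque

    cross : List (X × X)
    cross = filter crossing? pairs

    ∈-cross⁺ : ∀ {e} → Crossing e → e ∈ cross
    ∈-cross⁺ c = ∈-filter⁺ crossing? (∈-pairs _) c

    ∈-cross⁻ : ∀ {e} → e ∈ cross → Crossing e
    ∈-cross⁻ e∈ = proj₂ (∈-filter⁻ crossing? {xs = pairs} e∈)

    cross-unique : Unique cross
    cross-unique = Unique.filter⁺ crossing? (Unique.cartesianProduct⁺ vertices-unique vertices-unique)

  module _ (rank : X → ℕ) {edges : List (X × X)}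
           (ascending : All (Ascending rank) edges) (unique : Unique edges)
           (sound : ∀ {u v} → (u , v) ∈ edges → Adj P u v × level u ≡ level v)
           (complete : ∀ {u v} → level u ≡ level v → Adj P u v → (u , v) ∈ edges ⊎ (v , u) ∈ edges)
           where

    module _ {A : List (X × X)} (fs : Pointwise Flip edges A) where

      D : Digraph X
      D = ofList (cross ++ A)

      A-edge : ∀ {u v} → (u , v) ∈ A → Adj P u v × level u ≡ level v
      A-edge e∈ = [ sound , Product.map (symm P) sym ∘ sound ]′ (flip-∈⁻ fs e∈)

      A-unique : Unique A
      A-unique = flip-unique rank fs ascending unique

      disjoint : ∀ {e} → ¬ (e ∈ cross × e ∈ A)
      disjoint (e∈ , e∈′) = ℕ.<⇒≢ (proj₂ (∈-cross⁻ e∈)) (proj₂ (A-edge e∈′))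

      adjacent : ∀ {u v} → (u , v) ∈ cross ++ A → Adj P u v
      adjacent e∈ = [ proj₁ ∘ ∈-cross⁻ , proj₁ ∘ A-edge ]′ (∈-++⁻ cross e∈)

      arcs↭ : arcs D ↭ cross ++ A
      arcs↭ = arcs-ofList {L = cross ++ A} (Unique.++⁺ cross-unique A-unique disjoint)
        (All.tabulate λ e∈ eq → irrefl P eq (adjacent e∈))

      -- With `level` as the weight, the arcs of `cross` increase it and those of `A` keep it, so
      -- exactly the former are dropped.
      oddD : closures A [] [] ≡ true → closures (arcs D) [] [] ≡ true
      oddD odd = trans (closures-↭ arcs↭ [] []) (trans
        (closures-drop level cross A
          (All.tabulate (proj₂ ∘ ∈-cross⁻))
          (All.tabulate λ e∈ → ℕ.≤-reflexive (proj₂ (A-edge e∈))) refl)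
        odd)

      orientation : IsOrientation D P
      orientation = record
        { arc⇒adj = adjacent ∘ proj₂
        ; adj⇒arc = λ {u} {v} a → orient u v a
        ; one-way = λ (_ , e∈) (_ , e∈′) → antisym (∈-++⁻ cross e∈) (∈-++⁻ cross e∈′) }
        where
        crossArc : ∀ {u v} → Adj P u v → level u < level v → (u , v) ∈ cross ++ A
        crossArc a lt = ∈-++⁺ˡ (∈-cross⁺ (a , lt))
        antisym : ∀ {u v} → (u , v) ∈ cross ⊎ (u , v) ∈ A → (v , u) ∈ cross ⊎ (v , u) ∈ A → _
        antisym (inj₁ e) (inj₁ e′) = ℕ.<-asym (proj₂ (∈-cross⁻ e)) (proj₂ (∈-cross⁻ e′))
        antisym (inj₁ e) (inj₂ e′) = ℕ.<⇒≢ (proj₂ (∈-cross⁻ e)) (sym (proj₂ (A-edge e′)))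
        antisym (inj₂ e) (inj₁ e′) = ℕ.<⇒≢ (proj₂ (∈-cross⁻ e′)) (sym (proj₂ (A-edge e)))
        antisym (inj₂ e) (inj₂ e′) = flip-one-way rank fs ascending unique e e′
        orient : ∀ u v → Adj P u v → Arc D u v ⊎ Arc D v u
        orient u v a = Sum.map ((λ eq → irrefl P eq a) ,_) ((λ eq → irrefl P (sym eq) a) ,_)
          (place (ℕ.<-cmp (level u) (level v)))
          where
          place : _ → (u , v) ∈ cross ++ A ⊎ (v , u) ∈ cross ++ A
          place (tri< lt _ _) = inj₁ (crossArc a lt)
          place (tri> _ _ gt) = inj₂ (crossArc (symm P a) gt)
          place (tri≈ _ eq _) = Sum.map (∈-++⁺ʳ cross) (∈-++⁺ʳ cross)
            ([ flip-∈⁺ fs , Sum.swap ∘ flip-∈⁺ fs ]′ (complete eq a))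

      indegree≤ : ∀ v → indegree (arcs D) v ≤ count v (heads cross) + count v (heads A)
      indegree≤ v = ℕ.≤-reflexive (begin
        indegree (arcs D) v                       ≡⟨ indegree-count (arcs D) v ⟩
        count v (heads (arcs D))                  ≡⟨ count-↭ v (↭.map⁺ proj₂ arcs↭) ⟩
        count v (heads (cross ++ A))              ≡⟨ cong (count v) (map-++ proj₂ cross A) ⟩
        count v (heads cross ++ heads A)          ≡⟨ count-++ v (heads cross) (heads A) ⟩
        count v (heads cross) + count v (heads A) ∎)
        where open ≡-Reasoning

    alonTarsi≤ : ∀ {cap p b} → expand edges (meets cap) p ≡ true →
                       (∀ v → count v (heads cross) + cap v ≤ b) →
                       ∃[ a ] (IsAlonTarsiNumber P a × a ≤ suc b)
    alonTarsi≤ {cap} {p} {b} oddEdges few =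
      let A , fs , light , odd = odd-orientation cap edges p oddEdges
          bound : ∀ v → indegree (arcs (D fs)) v ≤ b
          bound v = ℕ.≤-trans (indegree≤ fs v)
            (ℕ.≤-trans (ℕ.+-monoʳ-≤ (count v (heads cross)) (light v)) (few v))
          -- An Alon-Tarsi orientation for `k` has maximum in-degree exactly `k` minus one, so the
          -- orientation enters with its actual maximum, and `b` bounds that afterwards.
          a , isAT , a≤ = alonTarsiNumber P
            (D fs , orientation fs , refl , odd⇒even≢odd (D fs) (oddD fs odd))
      in  a , isAT , ℕ.≤-trans a≤ (s≤s (maxIndegree≤ (D fs) bound))

-- The prisms G[Sᵢ] □ P_k

even⊎even-suc : ∀ n → Even n ⊎ Even (suc n)
even⊎even-suc zero    = inj₁ (divides 0 refl)
even⊎even-suc (suc n) = case even⊎even-suc n of λ where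
  (inj₁ e) → inj₂ (∣m∣n⇒∣m+n (divides 1 refl) e)
  (inj₂ e) → inj₁ e

module _ {X : Set} {{_ : Finite X}} where

  once-↭ : ∀ {n} (g : Fin n → X) {p q} → p ↭ q → once g p ↭ once g q
  once-↭ {zero}  g r = r
  once-↭ {suc n} g r = once-↭ (g ∘ suc) (prep _ r)

  once-++ : ∀ {n} (g : Fin n → X) ys p → once g (ys ++ p) ↭ ys ++ once g p
  once-++ {zero}  g ys p = ↭-refl
  once-++ {suc n} g ys p =
    ↭-trans (once-↭ (g ∘ suc) (↭-sym (shift (g zero) ys p))) (once-++ (g ∘ suc) ys _)

  final-↭ : ∀ k {m} (G : Fin (suc k) → Fin (suc m) → X) {p q} → p ↭ q → final k G p ↭ final k G q
  final-↭ zero    G r = once-↭ (G zero ∘ suc) (prep _ (prep _ r))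
  final-↭ (suc k) G r = final-↭ k (G ∘ suc) (twice-↭ (G zero) r)

  final-++ : ∀ k {m} (G : Fin (suc k) → Fin (suc m) → X) ys p →
             final k G (ys ++ p) ↭ ys ++ final k G p
  final-++ zero    G ys p = ↭-trans
    (once-↭ (G zero ∘ suc) (shifts (G zero zero ∷ G zero zero ∷ []) ys)) (once-++ (G zero ∘ suc) ys _)
  final-++ (suc k) G ys p =
    ↭-trans (final-↭ k (G ∘ suc) (twice-++ (G zero) ys p)) (final-++ k (G ∘ suc) ys _)

module _ {V : Set} {{F : Finite V}} (G : Graph V) {m : ℕ} (part : V → Fin m)
         (cycles : ∀ i → IsOddCycle (induced G (Block part i))) (k : ℕ) where

  private
    X : Set
    X = V × Fin (suc k)

    P : Graph X
    P = G □ path (suc k)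

    module Iso i = _≅_ (proj₂ (proj₂ (cycles i)))
    module Bij i = Inverse (Iso.bijection i)

    len : Fin m → ℕ
    len i = proj₁ (cycles i)

    φ : ∀ i → Fin (3 + len i) → V
    φ i x = proj₁ (Bij.from i x)

    φ-part : ∀ i x → part (φ i x) ≡ i
    φ-part i x = proj₂ (Bij.from i x)

    -- Proofs of `part v ≡ i` are unique, so a member of a block is determined by its vertex.
    blockEq : ∀ {i} {u v : ∃ (Block part i)} → proj₁ u ≡ proj₁ v → u ≡ v
    blockEq {u = u , refl} {v = _ , refl} refl = refl

    φ-injective : ∀ i {x x′} → φ i x ≡ φ i x′ → x ≡ x′
    φ-injective i {x} {x′} eq = trans (sym (Bij.strictlyInverseˡ i x))
      (trans (cong (Bij.to i) (blockEq eq)) (Bij.strictlyInverseˡ i x′))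

    pos : ∀ v → Fin (3 + len (part v))
    pos v = Bij.to (part v) (v , refl)

    φ-pos : ∀ v → φ (part v) (pos v) ≡ v
    φ-pos v = cong proj₁ (Bij.strictlyInverseʳ (part v) (v , refl))

    φ-adj⁺ : ∀ i {x x′} → Adj (cycle (len i)) x x′ → Adj G (φ i x) (φ i x′)
    φ-adj⁺ i {x} {x′} a = Equivalence.from (Iso.adjacency i (Bij.from i x) (Bij.from i x′))
      (subst₂ (Adj (cycle (len i))) (sym (Bij.strictlyInverseˡ i x)) (sym (Bij.strictlyInverseˡ i x′)) a)

    φ-adj⁻ : ∀ i {x x′} → Adj G (φ i x) (φ i x′) → Adj (cycle (len i)) x x′
    φ-adj⁻ i {x} {x′} a =
      subst₂ (Adj (cycle (len i))) (Bij.strictlyInverseˡ i x) (Bij.strictlyInverseˡ i x′)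
        (Equivalence.to (Iso.adjacency i (Bij.from i x) (Bij.from i x′)) a)

    block : X → Fin m
    block = part ∘ proj₁

    node : ∀ i → Fin (suc k) → Fin (3 + len i) → X
    node i t x = φ i x , t

    node-injective : ∀ i → Injective₂ (node i)
    node-injective i eq = cong proj₂ eq , φ-injective i (cong proj₁ eq)

    isNode : ∀ v → v ≡ node (block v) (proj₂ v) (pos (proj₁ v))
    isNode (v , t) = cong (_, t) (sym (φ-pos v))

    rank : X → ℕ
    rank (v , t) = toℕ t + toℕ (pos v)

    rank-node : ∀ i t x → rank (node i t x) ≡ toℕ t + toℕ x
    rank-node i t x = cong (toℕ t +_) (same (φ-part i x) (φ-pos (φ i x)))
      where
      -- `pos (φ i x)` lies on the cycle of `part (φ i x)`, which is only propositionally `i`.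
      -- Positions are therefore compared as numbers, for a variable block `j`.
      same : ∀ {j y} → j ≡ i → φ j y ≡ φ i x → toℕ y ≡ toℕ x
      same refl eq = cong toℕ (φ-injective i eq)

    -- The in-degrees of the last row have their exception at the vertex numbered `zero` on the
    -- cycle of its own block. The defect in the first row is not recorded here but supplied by
    -- `starts`.
    cap : X → ℕ
    cap (v , t) =
      if does (t Fin.≟ fromℕ k) ∧ not (does (v ≟ φ (part v) zero)) then 1 else 2

    cap≤2 : ∀ v → cap v ≤ 2
    cap≤2 (v , t) with does (t Fin.≟ fromℕ k) ∧ not (does (v ≟ φ (part v) zero))
    ... | true  = s≤s z≤n
    ... | false = ℕ.≤-refl

    loads : ∀ i → Loads cap (node i)
    loads i = record
      { below = λ t x ne → cong (λ b → if b ∧ _ then 1 else 2) (dec-false (t Fin.≟ fromℕ k) ne)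
      ; topZero = cong (if_then 1 else 2) (trans
          (cong (λ b → does (fromℕ k Fin.≟ fromℕ k) ∧ not b)
            (dec-true (φ i zero ≟ _) (cong (λ j → φ j zero) (sym (φ-part i zero)))))
          (∧-zeroʳ _))
      ; topSuc = λ x → cong (if_then 1 else 2) (cong₂ (λ a b → a ∧ not b)
          (dec-true (fromℕ k Fin.≟ fromℕ k) refl)
          (dec-false (φ i (suc x) ≟ _) λ eq → case
            φ-injective i (trans eq (cong (λ j → φ j zero) (φ-part i (suc x)))) of λ ())) }

    node≢ : ∀ {i t x v} → block v ≢ i → node i t x ≢ v
    node≢ {i} {t} {x} ne refl = ne (φ-part i x)

    -- The cycle of block `i` has `3 + len i` vertices, an odd number, so its predecessor is even.
    even : ∀ i b → ⨁ {suc (suc (len i))} (λ _ → b) ≡ false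
    even i = ⨁-even (2 + len i)
      ([ id , (λ e → contradiction e (proj₁ (proj₂ (cycles i)))) ]′ (even⊎even-suc (2 + len i)))

    -- The defect l = 1 of the first row: start i fills one unit of its capacity without an arc.
    start : Fin m → X
    start i = node i zero (suc zero)

    -- Opaque, because otherwise expand (prism i) unfolds to exponentially many terms.
    opaque

      prism : Fin m → List (X × X)
      prism i = grid k (suc (len i)) (node i)

      prism-odd : ∀ i {H} → Invariant H → (∀ t x → Elimination.Capped cap H (node i t x)) →
                  ∀ p → (∀ t → Clean (node i t) p) →
                  expand (prism i) H (start i ∷ p) ≡ H (final k (node i) p)
      prism-odd i inv capped p c =
        proj₂ (grid-odd cap k (suc (len i)) (even i) (node-injective i) (loads i) inv capped p c) zero

      prism-avoids : ∀ i {v} → block v ≢ i → Avoids v (prism i)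
      prism-avoids i {v} ne = grid-avoids cap k (suc (len i)) λ t x → node≢ {i} {t} {x} {v} ne

      ∈-prism⁺ : ∀ i {t x t′ x′} → Link t x t′ x′ → (node i t x , node i t′ x′) ∈ prism i
      ∈-prism⁺ i = ∈-grid⁺ k (suc (len i)) (node i)

      ∈-prism⁻ : ∀ i {e} → e ∈ prism i →
                 ∃[ t ] ∃[ x ] ∃[ t′ ] ∃[ x′ ] (Link t x t′ x′ × e ≡ (node i t x , node i t′ x′))
      ∈-prism⁻ i = ∈-grid⁻ k (suc (len i)) (node i)

      prism-unique : ∀ i → Unique (prism i)
      prism-unique i = grid-unique k (len i) (node-injective i)

    -- All prisms together

    prisms : List (Fin m) → List (X × X)
    prisms is = concat (map prism is)

    finals : List (Fin m) → List X → List X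
    finals []       p = p
    finals (i ∷ is) p = finals is (final k (node i) p)

    Free : List (Fin m) → List X → Set
    Free is p = ∀ v → block v ∈ is → count v p ≡ 0

    free-tail : ∀ {i is p} → All (i ≢_) is → Free (i ∷ is) p → Free is (final k (node i) p)
    free-tail {i} i∉ fr v b∈ = trans
      (count-final-off k (λ t x → node≢ {i} {t} {x} {v} λ eq → All.lookup i∉ b∈ (sym eq)) _)
      (fr v (there b∈))

    prisms-avoid : ∀ {v is} → block v ∉ is → Avoids v (prisms is)
    prisms-avoid {v} {is} b∉ = All.concat⁺ (All.map⁺ (All.tabulate λ {i} i∈ →
      prism-avoids i λ eq → b∉ (subst (_∈ is) (sym eq) i∈)))

    count-starts : ∀ {v is} → block v ∉ is → ∀ p → count v (map start is ++ p) ≡ count v p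
    count-starts {is = []}     b∉ p = refl
    count-starts {v} {i ∷ is} b∉ p = trans
      (count-miss _ (node≢ {i} {zero} {suc zero} {v} (b∉ ∘ here)))
      (count-starts {v} {is} (b∉ ∘ there) p)

    -- The prisms are disjoint. While that of `i` is expanded, the expansion `K` of the others acts
    -- as the demand, and neither their edges nor their charges touch block `i`.
    prisms-expand : ∀ is → Unique is → ∀ p → Free is p →
      expand (prisms is) (meets cap) (map start is ++ p) ≡ meets cap (finals is p)
    prisms-expand []       _         p fr = refl
    prisms-expand (i ∷ is) (i∉ ∷ u) p fr = begin
      expand (prism i ++ prisms is) (meets cap) (start i ∷ map start is ++ p)
        ≡⟨ expand-++ (prism i) (prisms is) (meets cap) (start i ∷ map start is ++ p) ⟩
      expand (prism i) K (start i ∷ map start is ++ p)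
        ≡⟨ prism-odd i Kinv
             (λ t x → Elimination.expand-capped cap (prisms is) (prisms-avoid (off t x))
                        (meets-capped cap (node i t x)))
             (map start is ++ p)
             (λ t x → trans (count-starts {node i t x} {is} (off t x) p)
                            (fr (node i t x) (here (φ-part i x)))) ⟩
      K (final k (node i) (map start is ++ p))
        ≡⟨ Kinv (final-++ k (node i) (map start is) p) ⟩
      K (map start is ++ final k (node i) p)
        ≡⟨ prisms-expand is u (final k (node i) p) (free-tail i∉ fr) ⟩
      meets cap (finals is (final k (node i) p)) ∎
      where
      open ≡-Reasoning
      K : List X → Bool
      K = expand (prisms is) (meets cap)
      Kinv : Invariant K
      Kinv = expand-invariant (prisms is) (meets-invariant cap)
      off : ∀ t x → block (node i t x) ∉ is
      off t x b∈ = All.lookup i∉ (subst (_∈ is) (φ-part i x) b∈) refl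

    count-finals-off : ∀ is {v} → block v ∉ is → ∀ p → count v (finals is p) ≡ count v p
    count-finals-off []       b∉ p = refl
    count-finals-off (i ∷ is) {v} b∉ p = trans (count-finals-off is (b∉ ∘ there) _)
      (count-final-off k (λ t x → node≢ {i} {t} {x} {v} (b∉ ∘ here)) p)

    count-finals : ∀ is → Unique is → ∀ p → Free is p → ∀ v → block v ∈ is →
                   count v (finals is p) ≡ cap v
    count-finals (i ∷ is) (i∉ ∷ u) p fr v (there b∈) = count-finals is u _ (free-tail i∉ fr) v b∈
    count-finals (_ ∷ is) (i∉ ∷ u) p fr v (here refl) = trans
      (count-finals-off is (λ b∈ → All.lookup i∉ b∈ refl) _)
      (subst (λ w → count w (final k (node (block v)) p) ≡ cap w) (sym (isNode v))
        (count-final cap k (node-injective _) (loads _) p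
          (λ t x → fr _ (here (φ-part _ x))) (proj₂ v) (pos (proj₁ v))))

    edges : List (X × X)
    edges = prisms (allFin m)

    starts : List X
    starts = map start (allFin m) ++ []

    edges-odd : expand edges (meets cap) starts ≡ true
    edges-odd = trans (prisms-expand (allFin m) (Unique.allFin⁺ m) [] (λ v _ → count-[] v))
      (trans (meets-does cap _) (dec-true (meets? cap (finals (allFin m) [])) λ v →
        count-finals (allFin m) (Unique.allFin⁺ m) [] (λ v _ → count-[] v) v (∈-allFin _)))

    record IsLink (e : X × X) : Set where
      constructor isLink
      field
        {i} : Fin m
        {t t′} : Fin (suc k)
        {x x′} : Fin (3 + len i)
        link : Link t x t′ x′
        eq : e ≡ (node i t x , node i t′ x′)

    ∈-edges⁻ : ∀ {e} → e ∈ edges → IsLink e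
    ∈-edges⁻ e∈ with ∈-concat⁻′ (map prism (allFin m)) e∈
    ... | _ , e∈l , l∈ with i , _ , refl ← ∈-map⁻ prism l∈
      with _ , _ , _ , _ , l , eq ← ∈-prism⁻ i e∈l = isLink l eq

    ∈-edges⁺ : ∀ i {t x t′ x′} → Link t x t′ x′ → (node i t x , node i t′ x′) ∈ edges
    ∈-edges⁺ i l = ∈-concat⁺′ (∈-prism⁺ i l) (∈-map⁺ prism (∈-allFin i))

    edges-ascending : All (Ascending rank) edges
    edges-ascending = All.tabulate λ e∈ → case ∈-edges⁻ e∈ of λ where
      (isLink {i} {t} {t′} {x} {x′} l refl) →
        subst₂ _<_ (sym (rank-node i t x)) (sym (rank-node i t′ x′)) (link-< l)

    edges-unique : Unique edges
    edges-unique = Unique.concat⁺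
      (All.map⁺ (All.tabulate λ {i} _ → prism-unique i))
      (AllPairs.map⁺ (AllPairs.map apart (Unique.allFin⁺ m)))
      where
      inPrism : ∀ i {e} → e ∈ prism i → block (proj₁ e) ≡ i
      inPrism i e∈ with _ , x , _ , _ , _ , refl ← ∈-prism⁻ i e∈ = φ-part i x
      apart : ∀ {i j} → i ≢ j → Disjoint (prism i) (prism j)
      apart {i} {j} i≢j (e∈ , e∈′) = i≢j (trans (sym (inPrism i e∈)) (inPrism j e∈′))

    link-adj : ∀ i {t x t′ x′} → Link t x t′ x′ → Adj P (node i t x) (node i t′ x′)
    link-adj i (up eq)   = inj₁ (refl , inj₁ eq)
    link-adj i (step eq) = inj₂ (refl , φ-adj⁺ i (inj₁ (inj₁ eq)))
    link-adj i wrap      = inj₂ (refl , φ-adj⁺ i (inj₂ (inj₂ (Fin.toℕ-fromℕ _ , refl))))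

    ∈-edges-wrap : ∀ i {t x x′} → toℕ x ≡ 0 → toℕ x′ ≡ 2 + len i →
                   (node i t x , node i t x′) ∈ edges
    ∈-edges-wrap i {t} {zero} refl last = subst (λ x → (node i t zero , node i t x) ∈ edges)
      (Fin.toℕ-injective (trans (Fin.toℕ-fromℕ _) (sym last))) (∈-edges⁺ i wrap)

    adj-link : ∀ i {t x t′ x′} → Adj P (node i t x) (node i t′ x′) →
               (node i t x , node i t′ x′) ∈ edges ⊎ (node i t′ x′ , node i t x) ∈ edges
    adj-link i {t} {x} {t′} {x′} (inj₁ (eq , a)) with refl ← φ-injective i {x} {x′} eq =
      Sum.map (∈-edges⁺ i ∘ up) (∈-edges⁺ i ∘ up) a
    adj-link i {t} {x} {t′} {x′} (inj₂ (refl , a)) with φ-adj⁻ i a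
    ... | inj₁ (inj₁ eq) = inj₁ (∈-edges⁺ i (step eq))
    ... | inj₂ (inj₁ eq) = inj₂ (∈-edges⁺ i (step eq))
    ... | inj₁ (inj₂ (last , first)) = inj₂ (∈-edges-wrap i first last)
    ... | inj₂ (inj₂ (last , first)) = inj₁ (∈-edges-wrap i first last)

    sameBlock-edge : ∀ {u v} → block u ≡ block v → Adj P u v → (u , v) ∈ edges ⊎ (v , u) ∈ edges
    sameBlock-edge {u} {v} eq a =
      subst₂ (λ u v → (u , v) ∈ edges ⊎ (v , u) ∈ edges) (sym (isNode u)) (sym v≡)
        (adj-link (block u) (subst₂ (Adj P) (isNode u) v≡ a))
      where
      asNode : ∀ {i} → i ≡ block v → ∃[ x ] v ≡ node i (proj₂ v) x
      asNode refl = _ , isNode v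
      v≡ = proj₂ (asNode eq)

    -- Arcs between blocks and the bound on the in-degrees

    level : X → ℕ
    level = toℕ ∘ block

    sound : ∀ {u v} → (u , v) ∈ edges → Adj P u v × level u ≡ level v
    sound e∈ with isLink {i} {x = x} {x′} l refl ← ∈-edges⁻ e∈ =
      link-adj i l , cong toℕ (trans (φ-part i x) (sym (φ-part i x′)))

    crossing : List (X × X)
    crossing = cross P level

    -- Edges along `path (suc k)` keep the vertex of `G` and hence the block. An arc between blocks
    -- therefore stays within one copy of `G` and comes from an earlier neighbour.
    count-crossing : ∀ v → count v (heads crossing) ≤ #earlierNeighbours G part (proj₁ v) (block v)
    count-crossing (x , t) = ℕ.≤-trans (ℕ.≤-reflexive (sym (indegree-count crossing (x , t))))
      (ℕ.≤-trans
        (unique-length-≤ (Unique.filter⁺ (λ e → proj₂ e ≟ (x , t)) (cross-unique P level)) sub)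
        (ℕ.≤-reflexive (length-map (λ u → (u , t) , (x , t)) earlier)))
      where
      earlier? = λ u → adj? G x u ×-dec (part u Fin.<? part x)
      earlier = filter earlier? vertices
      sub : ∀ {e} → e ∈ filter (λ e → proj₂ e ≟ (x , t)) crossing →
            e ∈ map (λ u → (u , t) , (x , t)) earlier
      sub e∈ with ∈-filter⁻ (λ e → proj₂ e ≟ (x , t)) {xs = crossing} e∈
      ... | e∈c , refl with ∈-cross⁻ P level e∈c
      ...   | inj₁ (refl , _) , lt = contradiction lt (ℕ.<-irrefl refl)
      ...   | inj₂ (refl , a) , lt =
        ∈-map⁺ (λ u → (u , t) , (x , t)) (∈-filter⁺ earlier? (∈-vertices _) (symm G a , lt))

    earlier≤ : ∀ {ρ} → (∀ i → 1 ≤ toℕ i → ∀ v → Block part i v → #earlierNeighbours G part v i ≤ ρ) →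
               ∀ v → #earlierNeighbours G part (proj₁ v) (block v) ≤ ρ
    earlier≤ few (x , t) = case 1 ℕ.≤? toℕ (part x) of λ where
      (yes pos) → few (part x) pos x refl
      -- The block with index 0, where `few` says nothing: no vertex lies in an earlier block.
      (no  ¬pos) → ℕ.≤-trans (ℕ.≤-reflexive (cong length (filter-none
        (λ u → adj? G x u ×-dec (part u Fin.<? part x)) {vertices}
        (All.tabulate λ _ (_ , lt) → ¬pos (ℕ.≤-trans (s≤s z≤n) lt))))) z≤n

  alonTarsi≤3+ρ : ∀ {ρ} →
    (∀ i → 1 ≤ toℕ i → ∀ v → Block part i v → #earlierNeighbours G part v i ≤ ρ) →
    ∃[ a ] (IsAlonTarsiNumber P a × a ≤ 3 + ρ)
  alonTarsi≤3+ρ {ρ} few =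
    alonTarsi≤ {X = X} {{finite-× {{F}} {{finite-Fin}}}} P level rank {edges}
      edges-ascending edges-unique sound (λ {u} {v} eq → sameBlock-edge {u} {v} (Fin.toℕ-injective eq))
      {cap} {starts} {2 + ρ} edges-odd bound
    where
    bound : ∀ v → count v (heads crossing) + cap v ≤ 2 + ρ
    bound v = ℕ.≤-trans (ℕ.+-mono-≤ (ℕ.≤-trans (count-crossing v) (earlier≤ few v)) (cap≤2 v))
      (ℕ.≤-reflexive (ℕ.+-comm ρ 2))

theorem8 : {V : Set} {{_ : Finite V}} (G : Graph V)
    (m : ℕ) (part : V → Fin m) →
    (∀ i → IsOddCycle (induced G (Block part i))) →
    (ρ : ℕ) →
    (∀ i → 1 ≤ toℕ i → ∀ v → Block part i v → #earlierNeighbours G part v i ≤ ρ) →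
    (m ≡ 1 → ρ ≡ 0) →
    (k : ℕ) → 1 ≤ k →
    ∃[ a ] (IsAlonTarsiNumber (G □ path k) a × a ≤ 3 + ρ)
theorem8 {V} {{F}} G m part cycles ρ few _ (suc k) _ =
  alonTarsi≤3+ρ {V} {{F}} G {m} part cycles k {ρ} few
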